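{- Let $\mathbb{F}$ be a field and let $B_0,B_1,\ldots,B_n$ be $m\times m$ matrices over $\mathbb{F}$. If $B_1,\ldots,B_n$ are of rank one, then matrix completion for the matrix $B_0+x_1B_1+\cdots+x_nB_n$ can be done deterministically in $\mathrm{poly}(m,n)$ field operations. That is, there is a deterministic algorithm which, given $B_0,\ldots,B_n$ with $B_1,\ldots,B_n$ of rank one, uses a number of operations in $\mathbb{F}$ bounded by a polynomial in $m$ and $n$ and outputs $(\alpha_1,\ldots,\alpha_n)\in\mathbb{F}^n$ such that $$\mathrm{rk}\Big(B_0+\sum_{i=1}^n\alpha_iB_i\Big)=\max_{(\beta_1,\ldots,\beta_n)\in\mathbb{F}^n}\mathrm{rk}\Big(B_0+\sum_{i=1}^n\beta_iB_i\Big).$$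
   Context: A linear matrix over $\mathbb{F}$ is a matrix whose entries are polynomials of degree at most one in $\mathbb{F}[x_1,\ldots,x_n]$. Matrix completion (maximum rank matrix completion) for a linear matrix is the problem of finding an assignment of values from $\mathbb{F}$ to the variables $x_1,\ldots,x_n$ such that the rank of the resulting matrix over $\mathbb{F}$ is maximum over all assignments from $\mathbb{F}^n$. Field operations are arithmetic operations and equality tests in $\mathbb{F}$. The matrix $B_0$ is of arbitrary rank, and the field $\mathbb{F}$ is arbitrary (in particular possibly small and finite). -}

module Defs where

open import Level using (Level; _⊔_) renaming (suc to lsuc)
open import Algebra.Bundles using (CommutativeRing)
open import Data.Fin using (Fin)
open import Data.Nat as ℕ using (ℕ; suc; _≤_)
open import Data.Product using (∃; _×_; proj₁)
open import Data.Vec.Functional using (Vector; _∷_; concat; map; transpose)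
open import Function using (_∘_)
open import Relation.Binary.Definitions using (Decidable)
open import Relation.Nullary using (¬_; yes; no)
open import Relation.Unary using (Pred; _≐_)
import Algebra.Properties.Monoid.Sum as Sum

-- A field in the classical sense: equality is decidable, as is needed for
-- equality tests to be available to algorithms.
record Field (c ℓ : Level) : Set (lsuc (c ⊔ ℓ)) where
  infix 8 _⁻¹
  infix 4 _≟_
  field
    commutativeRing : CommutativeRing c ℓ
  open CommutativeRing commutativeRing public
  field
    _≟_     : Decidable _≈_
    1≉0     : ¬ (1# ≈ 0#)
    inverse : ∀ x → ¬ (x ≈ 0#) → ∃ λ y → x * y ≈ 1#

  -- Made total by 0⁻¹ = 0.
  _⁻¹ : Carrier → Carrier
  x ⁻¹ with x ≟ 0#
  ... | yes _   = 0#
  ... | no  x≉0 = proj₁ (inverse x x≉0)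

module LinearAlgebra {c ℓ : Level} (F : Field c ℓ) where
  open Field F
  open Sum +-monoid public using (sum)

  Matrix : ℕ → ℕ → Set c
  Matrix m n = Vector (Vector Carrier n) m

  lincomb : ∀ {k m} → Vector Carrier k → Vector (Vector Carrier m) k → Vector Carrier m
  lincomb a v i = sum (λ j → a j * v j i)

  Span : ∀ {k m} → Vector (Vector Carrier m) k → Pred (Vector Carrier m) (c ⊔ ℓ)
  Span v w = ∃ λ a → ∀ i → w i ≈ lincomb a v i

  LinearlyIndependent : ∀ {k m} → Vector (Vector Carrier m) k → Set (c ⊔ ℓ)
  LinearlyIndependent v =
    ∀ a → (∀ i → lincomb a v i ≈ 0#) → ∀ j → a j ≈ 0#

  -- The rank is the dimension of the column space: some r vectors form a basis of it.
  HasRank : ∀ {m n} → Matrix m n → ℕ → Set (c ⊔ ℓ)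
  HasRank {m} A r =
    ∃ λ (b : Vector (Vector Carrier m) r) →
      LinearlyIndependent b × Span b ≐ Span (transpose A)

  -- B₀ + α₁ B₁ + ⋯ + αₙ Bₙ
  completion : ∀ {m n} → Matrix m m → Vector (Matrix m m) n → Vector Carrier n → Matrix m m
  completion B₀ B α i j = B₀ i j + sum (λ k → α k * B k i j)

  IsMaxRankCompletion : ∀ {m n} → Matrix m m → Vector (Matrix m m) n → Vector Carrier n → Set (c ⊔ ℓ)
  IsMaxRankCompletion B₀ B α =
    ∃ λ r → HasRank (completion B₀ B α) r ×
            (∀ β s → HasRank (completion B₀ B β) s → s ≤ r)

-- Algebraic computation trees. The algorithm for inputs of a given shape is a
-- well-founded tree that mentions no particular field: its only access to
-- field elements is through the values computed so far, numbered by Fin k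
-- (index 0 is the newest), and through the outcomes of equality tests.

data Instruction (k : ℕ) : Set where
  const0 const1   : Instruction k
  add sub mul div : Fin k → Fin k → Instruction k

data Tree (r : ℕ) : ℕ → Set where
  output  : ∀ {k} → Vector (Fin k) r → Tree r k
  compute : ∀ {k} → Instruction k → Tree r (suc k) → Tree r k
  ifEqual : ∀ {k} → Fin k → Fin k → (equal unequal : Tree r k) → Tree r k

module Execution {c ℓ : Level} (F : Field c ℓ) where
  open Field F
  open LinearAlgebra F using (Matrix)

  -- Division by zero yields 0.
  eval : ∀ {k} → Instruction k → Vector Carrier k → Carrier
  eval const0    ρ = 0#
  eval const1    ρ = 1#
  eval (add i j) ρ = ρ i + ρ j
  eval (sub i j) ρ = ρ i - ρ j
  eval (mul i j) ρ = ρ i * ρ j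
  eval (div i j) ρ = ρ i * ρ j ⁻¹

  run : ∀ {r k} → Tree r k → Vector Carrier k → Vector Carrier r
  run (output o)        ρ = ρ ∘ o
  run (compute e t)     ρ = run t (eval e ρ ∷ ρ)
  run (ifEqual i j t u) ρ with ρ i ≟ ρ j
  ... | yes _ = run t ρ
  ... | no  _ = run u ρ

  -- The number of field operations and equality tests on the path taken.
  cost : ∀ {r k} → Tree r k → Vector Carrier k → ℕ
  cost (output o)        ρ = 0
  cost (compute e t)     ρ = suc (cost t (eval e ρ ∷ ρ))
  cost (ifEqual i j t u) ρ with ρ i ≟ ρ j
  ... | yes _ = suc (cost t ρ)
  ... | no  _ = suc (cost u ρ)

  -- All entries of B₀, B₁, …, Bₙ, each matrix row by row.
  encode : ∀ {m n} → Matrix m m → Vector (Matrix m m) n → Vector Carrier (suc n ℕ.* (m ℕ.* m))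
  encode B₀ B = concat (map concat (B₀ ∷ B))

-- Polynomials in two indeterminates with coefficients in ℕ.
data Polynomial₂ : Set where
  con     : ℕ → Polynomial₂
  X Y     : Polynomial₂
  _⊕_ _⊗_ : Polynomial₂ → Polynomial₂ → Polynomial₂

evalPoly : Polynomial₂ → ℕ → ℕ → ℕ
evalPoly (con a) x y = a
evalPoly X       x y = x
evalPoly Y       x y = y
evalPoly (p ⊕ q) x y = evalPoly p x y ℕ.+ evalPoly q x y
evalPoly (p ⊗ q) x y = evalPoly p x y ℕ.* evalPoly q x y

{-# OPTIONS --safe #-}

-- Write A = B₀ + Σ αₖ Bₖ with α ∈ {0,1}ⁿ and compute G with AGA = A by elimination. Call k a source
-- if Bₖ does not vanish on ker A (that is, Bₖ G A ≠ Bₖ), a sink if im Bₖ ⊄ im A (that is,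
-- A G Bₖ ≠ Bₖ), and draw an edge k → l if Bₗ G Bₖ ≠ 0.
--
-- If no sink can be reached from a source, let S be the set of the k from which no sink can be
-- reached. For every β, with d = β - α,
--   A + Σ dₖ Bₖ = (1 + (Σ_{k ∉ S} dₖ Bₖ) G) A (1 + G (Σ_{k ∈ S} dₖ Bₖ)),
-- so the rank of A is maximal.
--
-- Otherwise flip αₖ along a shortest path from a source to a sink. Since the Bₖ have rank one, a
-- vector killed by the new matrix A′ is killed by each Bₖ on the path, by induction from the sink.
-- Hence ker A′ ⊆ ker A, and the source makes the inclusion strict. This happens at most m times.

module Submission where

open import Level using (Level; _⊔_)
open import Data.Bool using (Bool; true; false; if_then_else_; not)
import Data.Bool.Properties as Bool
open import Data.Empty using (⊥-elim)
open import Data.Fin using (Fin; zero; suc; toℕ; punchIn; punchOut; combine)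
open import Data.Fin.Properties using (any?; all?; pigeonhole; ¬∀⟶∃¬; punchIn-punchOut; *↔×; remQuot-combine)
import Data.Fin.Properties as Fin
open import Data.Nat using (ℕ; zero; suc; z≤n; s≤s)
import Data.Nat as ℕ
import Data.Nat.Properties as ℕ
open import Data.Nat.Solver using (module +-*-Solver)
open import Data.Product using (∃; ∃₂; Σ-syntax; _×_; _,_; proj₁; proj₂; uncurry)
open import Data.Product.Function.NonDependent.Propositional using (_×-↔_)
open import Data.Sum using (_⊎_; inj₁; inj₂; [_,_]; map₂)
open import Data.Vec.Functional using (Vector; []; _∷_; concat; map; transpose; removeAt; insertAt)
open import Data.Vec.Functional.Properties using (insertAt-lookup; insertAt-punchIn)
open import Function using (_∘_; id; _↔_; Inverse)
open import Function.Construct.Composition using (_↔-∘_)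
open import Function.Construct.Identity using (↔-id)
open import Relation.Binary.PropositionalEquality as ≡ using (_≡_; _≢_)
open import Relation.Nullary using (¬_; Dec; yes; no; does; contradiction)
open import Relation.Nullary.Decidable using (_×-dec_; _⊎-dec_; _→-dec_; ¬?)
open import Relation.Nullary.Reflects using (Reflects; ofʸ; ofⁿ)
open import Relation.Unary using (_⊆_; _≐_)
import Algebra.Properties.Ring as RingProperties
import Algebra.Properties.Semiring.Sum as SemiringSum
import Relation.Binary.Reasoning.Setoid as SetoidReasoning
open import Defs

-- The field may have only two elements, so values cannot be drawn from a large set. Flipping a bit
-- changes a coefficient by 1 or -1, which is nonzero in every field, and the kernel argument asks
-- of d only that it be nonzero exactly on the path. The factorisation in turn holds for every d, so
-- the bits found are optimal against all β in the field and not only against other bits. The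
-- equation AGA = A is all that is asked of G: AG fixes exactly the vectors of im A, and ker A
-- consists exactly of the vectors GAy - y. Both tests thus become comparisons of entries of
-- products. Ranks are never computed. Progress is certified by a family of vectors whose images
-- under the current matrix are independent; a vector that A kills and A′ does not can be added to
-- it, because ker A′ ⊆ ker A. Everything combinatorial is decided by the outcomes of equality
-- tests, hence by the position in the tree, and costs no operations.

-- Reachability and shortest paths in a finite decidable graph.

module ShortestPath {n : ℕ} (Source Sink : Fin n → Set) (Edge : Fin n → Fin n → Set)
  (source? : ∀ i → Dec (Source i)) (sink? : ∀ i → Dec (Sink i))
  (edge? : ∀ i j → Dec (Edge i j)) where

  -- Distance is measured towards the sinks and cumulatively, in at most `t` edges. The sets
  -- therefore increase with `t` and stabilise; the complement of the stable set is the `S` of the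
  -- optimality argument.
  Reach : ℕ → Fin n → Set
  Reach zero    i = Sink i
  Reach (suc t) i = Reach t i ⊎ ∃ λ j → Edge i j × Reach t j

  reach? : ∀ t i → Dec (Reach t i)
  reach? zero    i = sink? i
  reach? (suc t) i = reach? t i ⊎-dec any? λ j → edge? i j ×-dec reach? t j

  Reach-mono : ∀ {s t i} → s ℕ.≤ t → Reach s i → Reach t i
  Reach-mono {t = zero}  ℕ.z≤n r = r
  Reach-mono {s} {suc t} s≤1+t r with s ℕ.≟ suc t
  ... | yes ≡.refl = r
  ... | no  s≢1+t  = inj₁ (Reach-mono (ℕ.≤-pred (ℕ.≤∧≢⇒< s≤1+t s≢1+t)) r)

  -- The premise ¬ Reach t i makes a path shortest, so no node has an edge to a node beyond its
  -- successor; skip only raises the index.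
  data Path : ℕ → Fin n → Set where
    stop : ∀ {i} → Sink i → Path 0 i
    skip : ∀ {t i} → Path t i → Path (suc t) i
    step : ∀ {t i j} → Edge i j → ¬ Reach t i → ¬ Source j → Path t j → Path (suc t) i

  infix 4 _∈_
  _∈_ : ∀ {t i} → Fin n → Path t i → Set
  _∈_ {i = i} k (stop _)       = k ≡ i
  k ∈ skip p                   = k ∈ p
  _∈_ {i = i} k (step _ _ _ p) = k ≡ i ⊎ k ∈ p

  _∈?_ : ∀ {t i} k (p : Path t i) → Dec (k ∈ p)
  _∈?_ {i = i} k (stop _)       = k Fin.≟ i
  k ∈? skip p                   = k ∈? p
  _∈?_ {i = i} k (step _ _ _ p) = k Fin.≟ i ⊎-dec k ∈? p

  start∈ : ∀ {t i} (p : Path t i) → i ∈ p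
  start∈ (stop _)       = ≡.refl
  start∈ (skip p)       = start∈ p
  start∈ (step _ _ _ _) = inj₁ ≡.refl

  path⇒reach : ∀ {t i} → Path t i → Reach t i
  path⇒reach (stop s)       = s
  path⇒reach (skip p)       = inj₁ (path⇒reach p)
  path⇒reach (step e _ _ p) = inj₂ (_ , e , path⇒reach p)

  Unreached : ℕ → Set
  Unreached t = ∀ i → Source i → ¬ Reach t i

  path : ∀ t → Unreached t → ∀ {i} → Reach (suc t) i → Path (suc t) i
  path′ : ∀ t → Unreached t → ∀ {i} → Reach t i → Path t i

  path t u {i} r with reach? t i
  ... | yes r′ = skip (path′ t u r′)
  ... | no ¬r with r
  ...   | inj₁ r′           = contradiction r′ ¬r
  ...   | inj₂ (j , e , rⱼ) = step e ¬r (λ s → u j s rⱼ) (path′ t u rⱼ)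

  path′ zero    u r = stop r
  path′ (suc t) u r = path t (λ i s → u i s ∘ inj₁) r

  -- The bound is raised one edge at a time: when a source first reaches a sink, `Unreached` still
  -- holds for the previous bound, so no later node of the path is a source.
  findPath : ∀ t → (∃ λ s → ∃ λ i → Source i × Path s i) ⊎ Unreached t
  findPath zero with any? (λ i → source? i ×-dec sink? i)
  ... | yes (i , s , z) = inj₁ (0 , i , s , stop z)
  ... | no  ¬∃          = inj₂ λ i s z → ¬∃ (i , s , z)
  findPath (suc t) with findPath t
  ... | inj₁ found = inj₁ found
  ... | inj₂ u with any? (λ i → source? i ×-dec reach? (suc t) i)
  ...   | yes (i , s , r) = inj₁ (suc t , i , s , path t u r)
  ...   | no  ¬∃          = inj₂ λ i s r → ¬∃ (i , s , r)

  Stable : ℕ → Set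
  Stable t = ∀ i → Reach (suc t) i → Reach t i

  stable? : ∀ t → Dec (Stable t)
  stable? t = all? λ i → reach? (suc t) i →-dec reach? t i

  growth : ∀ t → ¬ Stable t → ∃ λ i → Reach (suc t) i × ¬ Reach t i
  growth t ¬stable with any? (λ i → reach? (suc t) i ×-dec ¬? (reach? t i))
  ... | yes found = found
  ... | no  ¬∃    = contradiction stable ¬stable
    where
    stable : Stable t
    stable i r with reach? t i
    ... | yes r′ = r′
    ... | no  ¬r = contradiction (i , r , ¬r) ¬∃

  -- Each growing stage names a node that enters at that stage. Among n + 1 stages two name the same
  -- node, but after its earlier entry it already belongs to the later set.
  growth-bounded : ¬ ((t : Fin (suc n)) → ∃ λ i → Reach (suc (toℕ t)) i × ¬ Reach (toℕ t) i)
  growth-bounded new with pigeonhole (ℕ.n<1+n n) (proj₁ ∘ new)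
  ... | s , t , s<t , same =
    proj₂ (proj₂ (new t)) (≡.subst (Reach (toℕ t)) same (Reach-mono s<t (proj₁ (proj₂ (new s)))))

  stabilises : ∃ Stable
  stabilises with any? {suc n} (stable? ∘ toℕ)
  ... | yes (t , stable) = toℕ t , stable
  ... | no  ¬∃           = ⊥-elim (growth-bounded λ t → growth (toℕ t) λ stable → ¬∃ (t , stable))

  record Closed : Set₁ where
    field
      S       : Fin n → Set
      S?      : ∀ i → Dec (S i)
      source⇒ : ∀ i → Source i → S i
      sink⇒   : ∀ i → S i → ¬ Sink i
      edge⇒   : ∀ i j → S i → Edge i j → S j

  search : (∃ λ t → ∃ λ i → Source i × Path t i) ⊎ Closed
  search with stabilises
  ... | t , stable with findPath t
  ...   | inj₁ found = inj₁ found
  ...   | inj₂ u     = inj₂ record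
    { S       = ¬_ ∘ Reach t
    ; S?      = ¬? ∘ reach? t
    ; source⇒ = u
    ; sink⇒   = λ i ¬r z → ¬r (Reach-mono {t = t} ℕ.z≤n z)
    ; edge⇒   = λ i j ¬r e r → ¬r (stable i (inj₂ (j , e , r)))
    }

-- Linear dependence, exchange and bases over a field.

module VectorSpaces {c ℓ} (F : Field c ℓ) where
  open Field F hiding (zero)
  open LinearAlgebra F
  open SemiringSum semiring public
    using (sum-cong-≋; sum-remove; ∑-distrib-+; ∑-comm; *-distribˡ-sum; *-distribʳ-sum)
  open RingProperties ring public
  open SetoidReasoning setoid

  infix 4 _≋_
  _≋_ : ∀ {k} → Vector Carrier k → Vector Carrier k → Set ℓ
  x ≋ y = ∀ i → x i ≈ y i

  x+[y-x]≈y : ∀ x y → x + (y - x) ≈ y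
  x+[y-x]≈y x y = begin
    x + (y - x)   ≈⟨ +-comm x (y - x) ⟩
    (y - x) + x   ≈⟨ +-assoc y (- x) x ⟩
    y + (- x + x) ≈⟨ +-congˡ (-‿inverseˡ x) ⟩
    y + 0#        ≈⟨ +-identityʳ y ⟩
    y             ∎

  ⁻¹-inverse : ∀ {x} → ¬ x ≈ 0# → x * x ⁻¹ ≈ 1#
  ⁻¹-inverse {x} x≉0 with x ≟ 0#
  ... | yes x≈0  = contradiction x≈0 x≉0
  ... | no  x≉0′ = proj₂ (inverse x x≉0′)

  *-cancelʳ : ∀ {x y z} → ¬ z ≈ 0# → x * z ≈ y * z → x ≈ y
  *-cancelʳ {x} {y} {z} z≉0 xz≈yz = begin
    x              ≈⟨ undo x ⟨
    x * z * z ⁻¹   ≈⟨ *-congʳ xz≈yz ⟩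
    y * z * z ⁻¹   ≈⟨ undo y ⟩
    y              ∎
    where
    undo : ∀ u → u * z * z ⁻¹ ≈ u
    undo u = begin
      u * z * z ⁻¹   ≈⟨ *-assoc u z (z ⁻¹) ⟩
      u * (z * z ⁻¹) ≈⟨ *-congˡ (⁻¹-inverse z≉0) ⟩
      u * 1#         ≈⟨ *-identityʳ u ⟩
      u              ∎

  *-cancelˡ : ∀ {x y z} → ¬ z ≈ 0# → z * x ≈ z * y → x ≈ y
  *-cancelˡ {x} {y} {z} z≉0 zx≈zy = *-cancelʳ z≉0 (begin
    x * z ≈⟨ *-comm x z ⟩
    z * x ≈⟨ zx≈zy ⟩
    z * y ≈⟨ *-comm z y ⟩
    y * z ∎)

  sum-zero : ∀ {k} (t : Vector Carrier k) → (∀ i → t i ≈ 0#) → sum t ≈ 0#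
  sum-zero {zero}  t t≈0 = refl
  sum-zero {suc k} t t≈0 = begin
    t zero + sum (t ∘ suc) ≈⟨ +-cong (t≈0 zero) (sum-zero (t ∘ suc) (t≈0 ∘ suc)) ⟩
    0# + 0#                ≈⟨ +-identityˡ 0# ⟩
    0#                     ∎

  -- Cancel the sum over the other indices. In the kernel argument this isolates the term of the
  -- sink that ends the path.
  sum-agree : ∀ {k} (s t : Vector Carrier k) j →
              (∀ i → i ≢ j → s i ≈ t i) → sum s ≈ sum t → s j ≈ t j
  sum-agree {suc k} s t j agree sums = +-cancelʳ (sum (removeAt s j)) (s j) (t j) (begin
    s j + sum (removeAt s j) ≈⟨ sum-remove s ⟨
    sum s                    ≈⟨ sums ⟩
    sum t                    ≈⟨ sum-remove t ⟩
    t j + sum (removeAt t j) ≈⟨ +-congˡ (sum-cong-≋ λ i → agree (punchIn j i) (Fin.punchInᵢ≢i j i)) ⟨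
    t j + sum (removeAt s j) ∎)

  bit : Bool → Carrier
  bit b = if b then 1# else 0#

  unit : ∀ {k} → Fin k → Vector Carrier k
  unit j i = bit (does (j Fin.≟ i))

  unit-diagonal : ∀ {k} (j : Fin k) → unit j j ≈ 1#
  unit-diagonal j with j Fin.≟ j
  ... | yes _  = refl
  ... | no j≢j = contradiction ≡.refl j≢j

  unit-off : ∀ {k} {j i : Fin k} → i ≢ j → unit j i ≈ 0#
  unit-off {j = j} {i} i≢j with j Fin.≟ i
  ... | yes j≡i = contradiction (≡.sym j≡i) i≢j
  ... | no  _   = refl

  sum-single : ∀ {k} (t : Vector Carrier k) j → (∀ i → i ≢ j → t i ≈ 0#) → sum t ≈ t j
  sum-single {suc k} t j off = begin
    sum t                    ≈⟨ sum-remove t ⟩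
    t j + sum (removeAt t j) ≈⟨ +-congˡ (sum-zero (removeAt t j) λ i → off (punchIn j i) (Fin.punchInᵢ≢i j i)) ⟩
    t j + 0#                 ≈⟨ +-identityʳ (t j) ⟩
    t j                      ∎

  lincomb-congˡ : ∀ {k m} {a b : Vector Carrier k} (v : Vector (Vector Carrier m) k) →
                  a ≋ b → lincomb a v ≋ lincomb b v
  lincomb-congˡ v a≋b i = sum-cong-≋ λ j → *-congʳ (a≋b j)

  lincomb-congʳ : ∀ {k m} (a : Vector Carrier k) {v w : Vector (Vector Carrier m) k} →
                  (∀ j → v j ≋ w j) → lincomb a v ≋ lincomb a w
  lincomb-congʳ a v≋w i = sum-cong-≋ λ j → *-congˡ (v≋w j i)

  lincomb-cong-support : ∀ {k m} (a : Vector Carrier k) {v w : Vector (Vector Carrier m) k} →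
                         (∀ j → a j ≈ 0# ⊎ v j ≋ w j) → lincomb a v ≋ lincomb a w
  lincomb-cong-support a {v} {w} agree i = sum-cong-≋ λ j → term j (agree j)
    where
    term : ∀ j → a j ≈ 0# ⊎ v j ≋ w j → a j * v j i ≈ a j * w j i
    term j (inj₂ v≋w) = *-congˡ (v≋w i)
    term j (inj₁ a≈0) = begin
      a j * v j i ≈⟨ *-congʳ a≈0 ⟩
      0# * v j i  ≈⟨ zeroˡ _ ⟩
      0#          ≈⟨ zeroˡ _ ⟨
      0# * w j i  ≈⟨ *-congʳ a≈0 ⟨
      a j * w j i ∎

  lincomb-zero : ∀ {k m} (a : Vector Carrier k) {v : Vector (Vector Carrier m) k} →
                 (∀ j i → v j i ≈ 0#) → ∀ i → lincomb a v i ≈ 0#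
  lincomb-zero a v≈0 i = sum-zero _ λ j → trans (*-congˡ (v≈0 j i)) (zeroʳ (a j))

  lincomb-zeroˡ : ∀ {k m} {a : Vector Carrier k} (v : Vector (Vector Carrier m) k) →
                  (∀ j → a j ≈ 0#) → ∀ i → lincomb a v i ≈ 0#
  lincomb-zeroˡ v a≈0 i = sum-zero _ λ j → trans (*-congʳ (a≈0 j)) (zeroˡ (v j i))

  lincomb-unit : ∀ {k m} j (v : Vector (Vector Carrier m) k) → lincomb (unit j) v ≋ v j
  lincomb-unit j v i = begin
    lincomb (unit j) v i ≈⟨ sum-single _ j (λ l l≢j → trans (*-congʳ (unit-off l≢j)) (zeroˡ _)) ⟩
    unit j j * v j i     ≈⟨ *-congʳ (unit-diagonal j) ⟩
    1# * v j i           ≈⟨ *-identityˡ _ ⟩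
    v j i                ∎

  lincomb-+ˡ : ∀ {k m} (a b : Vector Carrier k) (v : Vector (Vector Carrier m) k) i →
               lincomb (λ j → a j + b j) v i ≈ lincomb a v i + lincomb b v i
  lincomb-+ˡ a b v i = begin
    lincomb (λ j → a j + b j) v i              ≈⟨ sum-cong-≋ (λ j → distribʳ (v j i) (a j) (b j)) ⟩
    sum (λ j → a j * v j i + b j * v j i)      ≈⟨ ∑-distrib-+ (λ j → a j * v j i) (λ j → b j * v j i) ⟩
    lincomb a v i + lincomb b v i              ∎

  lincomb-+ʳ : ∀ {k m} (a : Vector Carrier k) (v w : Vector (Vector Carrier m) k) i →
               lincomb a (λ j i → v j i + w j i) i ≈ lincomb a v i + lincomb a w i
  lincomb-+ʳ a v w i = begin
    lincomb a (λ j i → v j i + w j i) i        ≈⟨ sum-cong-≋ (λ j → distribˡ (a j) (v j i) (w j i)) ⟩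
    sum (λ j → a j * v j i + a j * w j i)      ≈⟨ ∑-distrib-+ (λ j → a j * v j i) (λ j → a j * w j i) ⟩
    lincomb a v i + lincomb a w i              ∎

  lincomb-scale : ∀ {k m} (a : Vector Carrier k) x (v : Vector (Vector Carrier m) k) i →
                  lincomb (λ j → x * a j) v i ≈ x * lincomb a v i
  lincomb-scale a x v i = begin
    lincomb (λ j → x * a j) v i      ≈⟨ sum-cong-≋ (λ j → *-assoc x (a j) (v j i)) ⟩
    sum (λ j → x * (a j * v j i))    ≈⟨ *-distribˡ-sum x (λ j → a j * v j i) ⟨
    x * lincomb a v i                ∎

  lincomb-lincomb : ∀ {k l m} (a : Vector Carrier k) (C : Vector (Vector Carrier l) k)
                    (v : Vector (Vector Carrier m) l) →
                    lincomb a (λ j → lincomb (C j) v) ≋ lincomb (lincomb a C) v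
  lincomb-lincomb a C v i = begin
    sum (λ j → a j * sum (λ t → C j t * v t i))   ≈⟨ sum-cong-≋ (λ j → *-distribˡ-sum (a j) (λ t → C j t * v t i)) ⟩
    sum (λ j → sum (λ t → a j * (C j t * v t i))) ≈⟨ ∑-comm (λ j t → a j * (C j t * v t i)) ⟩
    sum (λ t → sum (λ j → a j * (C j t * v t i))) ≈⟨ sum-cong-≋ (λ t → sum-cong-≋ λ j → *-assoc (a j) (C j t) (v t i)) ⟨
    sum (λ t → sum (λ j → a j * C j t * v t i))   ≈⟨ sum-cong-≋ (λ t → *-distribʳ-sum (v t i) (λ j → a j * C j t)) ⟨
    sum (λ t → sum (λ j → a j * C j t) * v t i)   ∎

  lincomb-swap : ∀ {k l m} (a : Vector Carrier k) (b : Vector Carrier l)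
                 (v : Vector (Vector (Vector Carrier m) l) k) →
                 lincomb a (λ j → lincomb b (v j)) ≋ lincomb b (λ t → lincomb a λ j → v j t)
  lincomb-swap a b v i = begin
    sum (λ j → a j * sum (λ t → b t * v j t i))     ≈⟨ sum-cong-≋ (λ j → *-distribˡ-sum (a j) (λ t → b t * v j t i)) ⟩
    sum (λ j → sum (λ t → a j * (b t * v j t i)))   ≈⟨ ∑-comm (λ j t → a j * (b t * v j t i)) ⟩
    sum (λ t → sum (λ j → a j * (b t * v j t i)))   ≈⟨ sum-cong-≋ (λ t → sum-cong-≋ λ j → exchange (a j) (b t) (v j t i)) ⟩
    sum (λ t → sum (λ j → b t * (a j * v j t i)))   ≈⟨ sum-cong-≋ (λ t → *-distribˡ-sum (b t) (λ j → a j * v j t i)) ⟨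
    sum (λ t → b t * sum (λ j → a j * v j t i))     ∎
    where
    exchange : ∀ x y z → x * (y * z) ≈ y * (x * z)
    exchange x y z = begin
      x * (y * z) ≈⟨ *-assoc x y z ⟨
      x * y * z   ≈⟨ *-congʳ (*-comm x y) ⟩
      y * x * z   ≈⟨ *-assoc y x z ⟩
      y * (x * z) ∎

  Dependent : ∀ {k m} → Vector (Vector Carrier m) k → Set (c ⊔ ℓ)
  Dependent v = ∃ λ a → (∀ i → lincomb a v i ≈ 0#) × ∃ λ j → ¬ a j ≈ 0#

  ∀-punchIn : ∀ {p k} {P : Fin (suc k) → Set p} q → P q → (∀ j → P (punchIn q j)) → ∀ j → P j
  ∀-punchIn {P = P} q Pq Ps j with q Fin.≟ j
  ... | yes ≡.refl = Pq
  ... | no  q≢j    = ≡.subst P (punchIn-punchOut q≢j) (Ps (punchOut q≢j))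

  module Elimination {k m} (v : Vector (Vector Carrier (suc m)) (suc k))
    (q : Fin (suc k)) (pivot : ¬ v q zero ≈ 0#) where

    -- The multiplier with which `v q` clears the first coordinate of another vector. Only the tails
    -- of `u` then matter, and the dimension drops by one.
    g : Vector Carrier k
    g j = - (v (punchIn q j) zero * v q zero ⁻¹)

    u : Vector (Vector Carrier (suc m)) k
    u j i = v (punchIn q j) i + g j * v q i

    u-zero : ∀ j → u j zero ≈ 0#
    u-zero j = begin
      y + - (y * z ⁻¹) * z   ≈⟨ +-congˡ (-‿distribˡ-* (y * z ⁻¹) z) ⟨
      y - y * z ⁻¹ * z       ≈⟨ +-congˡ (-‿cong (*-assoc y (z ⁻¹) z)) ⟩
      y - y * (z ⁻¹ * z)     ≈⟨ +-congˡ (-‿cong (*-congˡ (trans (*-comm (z ⁻¹) z) (⁻¹-inverse pivot)))) ⟩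
      y - y * 1#             ≈⟨ +-congˡ (-‿cong (*-identityʳ y)) ⟩
      y - y                  ≈⟨ -‿inverseʳ y ⟩
      0#                     ∎
      where
      y = v (punchIn q j) zero
      z = v q zero

    lincomb-u : ∀ a i → lincomb a u i ≈ sum (λ j → a j * g j) * v q i + lincomb a (removeAt v q) i
    lincomb-u a i = begin
      lincomb a u i                                                ≈⟨ lincomb-+ʳ a (removeAt v q) (λ j i → g j * v q i) i ⟩
      lincomb a (removeAt v q) i + sum (λ j → a j * (g j * v q i)) ≈⟨ +-congˡ (sum-cong-≋ λ j → *-assoc (a j) (g j) (v q i)) ⟨
      lincomb a (removeAt v q) i + sum (λ j → a j * g j * v q i)   ≈⟨ +-congˡ (*-distribʳ-sum (v q i) (λ j → a j * g j)) ⟨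
      lincomb a (removeAt v q) i + sum (λ j → a j * g j) * v q i   ≈⟨ +-comm _ _ ⟩
      sum (λ j → a j * g j) * v q i + lincomb a (removeAt v q) i   ∎

    independent : LinearlyIndependent (λ j i → u j (suc i)) → LinearlyIndependent v
    independent li a rel = ∀-punchIn q a-q≈0 a′≈0
      where
      a′ = removeAt a q
      Σag = sum (λ j → a′ j * g j)

      split : ∀ i → a q * v q i + lincomb a′ (removeAt v q) i ≈ 0#
      split i = trans (sym (sum-remove (λ j → a j * v j i))) (rel i)

      -- In coordinate `zero` the vectors `u` vanish, so there the relation determines the
      -- coefficient of `v q` through the nonzero pivot.
      a-q≈Σag : a q ≈ Σag
      a-q≈Σag = *-cancelʳ pivot (+-cancelʳ (lincomb a′ (removeAt v q) zero) _ _ (begin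
        a q * v q zero + lincomb a′ (removeAt v q) zero ≈⟨ split zero ⟩
        0#                                              ≈⟨ sum-zero _ (λ j → trans (*-congˡ (u-zero j)) (zeroʳ _)) ⟨
        lincomb a′ u zero                               ≈⟨ lincomb-u a′ zero ⟩
        Σag * v q zero + lincomb a′ (removeAt v q) zero ∎))

      a′≈0 : ∀ j → a′ j ≈ 0#
      a′≈0 = li a′ λ i → begin
        lincomb a′ u (suc i)                                      ≈⟨ lincomb-u a′ (suc i) ⟩
        Σag * v q (suc i) + lincomb a′ (removeAt v q) (suc i)     ≈⟨ +-congʳ (*-congʳ a-q≈Σag) ⟨
        a q * v q (suc i) + lincomb a′ (removeAt v q) (suc i)     ≈⟨ split (suc i) ⟩
        0#                                                        ∎

      a-q≈0 : a q ≈ 0#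
      a-q≈0 = trans a-q≈Σag (sum-zero _ λ j → trans (*-congʳ (a′≈0 j)) (zeroˡ (g j)))

    dependent : Dependent (λ j i → u j (suc i)) → Dependent v
    dependent (a′ , rel , j , a′j≉0) =
      a , rel′ , punchIn q j , a′j≉0 ∘ trans (sym (reflexive (insertAt-punchIn a′ q Σag j)))
      where
      Σag = sum (λ j → a′ j * g j)
      a = insertAt a′ q Σag

      rel-u : ∀ i → lincomb a′ u i ≈ 0#
      rel-u zero    = sum-zero _ (λ j → trans (*-congˡ (u-zero j)) (zeroʳ _))
      rel-u (suc i) = rel i

      rel′ : ∀ i → lincomb a v i ≈ 0#
      rel′ i = begin
        lincomb a v i                                     ≈⟨ sum-remove (λ j → a j * v j i) ⟩
        a q * v q i + lincomb (removeAt a q) (removeAt v q) i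
          ≈⟨ +-cong (*-congʳ (reflexive (insertAt-lookup a′ q Σag)))
                    (sum-cong-≋ λ j → *-congʳ (reflexive (insertAt-punchIn a′ q Σag j))) ⟩
        Σag * v q i + lincomb a′ (removeAt v q) i         ≈⟨ lincomb-u a′ i ⟨
        lincomb a′ u i                                    ≈⟨ rel-u i ⟩
        0#                                                ∎

  -- Induction on the number of coordinates: a first coordinate that vanishes throughout is dropped,
  -- any other is cleared by a pivot. Carrying `k ≤ m` along makes the dimension bound a by-product.
  dichotomy : ∀ m {k} (v : Vector (Vector Carrier m) k) →
              (LinearlyIndependent v × k ℕ.≤ m) ⊎ Dependent v
  dichotomy zero {zero}  v = inj₁ ((λ _ _ ()) , z≤n)
  dichotomy zero {suc k} v = inj₂ ((λ _ → 1#) , (λ ()) , zero , 1≉0)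
  dichotomy (suc m) {k} v with all? (λ j → v j zero ≟ 0#)
  dichotomy (suc m) {k} v | yes v₀≈0 with dichotomy m (λ j i → v j (suc i))
  ... | inj₁ (li , k≤m)           = inj₁ ((λ a rel → li a (rel ∘ suc)) , ℕ.m≤n⇒m≤1+n k≤m)
  ... | inj₂ (a , rel , nonzero)  = inj₂ (a , rel′ , nonzero)
    where
    rel′ : ∀ i → lincomb a v i ≈ 0#
    rel′ zero    = sum-zero _ λ j → trans (*-congˡ (v₀≈0 j)) (zeroʳ _)
    rel′ (suc i) = rel i
  dichotomy (suc m) {k} v | no ¬v₀≈0 with ¬∀⟶∃¬ k _ (λ j → v j zero ≟ 0#) ¬v₀≈0
  dichotomy (suc m) {suc k} v | no _ | q , pivot with dichotomy m (λ j i → Elimination.u v q pivot j (suc i))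
  ... | inj₁ (li , k≤m) = inj₁ (Elimination.independent v q pivot li , s≤s k≤m)
  ... | inj₂ dep        = inj₂ (Elimination.dependent v q pivot dep)

  independent⇒≤ : ∀ {m k} (v : Vector (Vector Carrier m) k) → LinearlyIndependent v → k ℕ.≤ m
  independent⇒≤ {m} v li with dichotomy m v
  ... | inj₁ (_ , k≤m)             = k≤m
  ... | inj₂ (a , rel , j , aj≉0)  = contradiction (li a rel j) aj≉0

  -- A relation among the coefficient vectors `C j` of the `v j` over `w` is also one among the
  -- `v j`. Hence the `C j` are independent vectors of length `l`.
  steinitz : ∀ {m k l} (v : Vector (Vector Carrier m) k) (w : Vector (Vector Carrier m) l) →
             LinearlyIndependent v → (∀ j → Span w (v j)) → k ℕ.≤ l
  steinitz v w li v∈w = independent⇒≤ C λ a rel → li a λ i → begin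
    lincomb a v i                      ≈⟨ lincomb-congʳ a (λ j → proj₂ (v∈w j)) i ⟩
    lincomb a (λ j → lincomb (C j) w) i ≈⟨ lincomb-lincomb a C w i ⟩
    lincomb (lincomb a C) w i          ≈⟨ lincomb-zeroˡ w rel i ⟩
    0#                                 ∎
    where
    C = λ j → proj₁ (v∈w j)

  Span-generator : ∀ {k m} (v : Vector (Vector Carrier m) k) j → Span v (v j)
  Span-generator v j = unit j , λ i → sym (lincomb-unit j v i)

  Span-least : ∀ {k l m} (v : Vector (Vector Carrier m) k) (w : Vector (Vector Carrier m) l) →
               (∀ j → Span w (v j)) → Span v ⊆ Span w
  Span-least v w v∈w {x} (a , x≈) = lincomb a C , λ i → begin
    x i                                 ≈⟨ x≈ i ⟩
    lincomb a v i                       ≈⟨ lincomb-congʳ a (λ j → proj₂ (v∈w j)) i ⟩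
    lincomb a (λ j → lincomb (C j) w) i ≈⟨ lincomb-lincomb a C w i ⟩
    lincomb (lincomb a C) w i           ∎
    where
    C = λ j → proj₁ (v∈w j)

  dependent-member : ∀ {k m} (v : Vector (Vector Carrier m) (suc k)) a j →
                     (∀ i → lincomb a v i ≈ 0#) → ¬ a j ≈ 0# → Span (removeAt v j) (v j)
  dependent-member v a j rel aj≉0 = (λ l → x * removeAt a j l) , λ i → sym (begin
    lincomb (λ l → x * removeAt a j l) (removeAt v j) i   ≈⟨ lincomb-scale (removeAt a j) x (removeAt v j) i ⟩
    x * lincomb (removeAt a j) (removeAt v j) i           ≈⟨ *-congˡ (rest i) ⟩
    x * - (a j * v j i)                                   ≈⟨ -‿distribˡ-* (a j ⁻¹) _ ⟨
    - (a j ⁻¹ * - (a j * v j i))                          ≈⟨ -‿cong (-‿distribʳ-* (a j ⁻¹) _) ⟨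
    - - (a j ⁻¹ * (a j * v j i))                          ≈⟨ -‿involutive _ ⟩
    a j ⁻¹ * (a j * v j i)                                ≈⟨ *-assoc (a j ⁻¹) (a j) (v j i) ⟨
    a j ⁻¹ * a j * v j i                                  ≈⟨ *-congʳ (trans (*-comm (a j ⁻¹) (a j)) (⁻¹-inverse aj≉0)) ⟩
    1# * v j i                                            ≈⟨ *-identityˡ (v j i) ⟩
    v j i                                                 ∎)
    where
    x = - (a j ⁻¹)
    rest : ∀ i → lincomb (removeAt a j) (removeAt v j) i ≈ - (a j * v j i)
    rest i = +-inverseʳ-unique (a j * v j i) _ (trans (sym (sum-remove (λ l → a l * v l i))) (rel i))

  -- Redundant vectors are discarded until the rest is independent. This supplies the rank that
  -- `IsMaxRankCompletion` asks for.
  basis : ∀ {k m} (v : Vector (Vector Carrier m) k) →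
          ∃ λ r → ∃ λ (b : Vector (Vector Carrier m) r) → LinearlyIndependent b × Span b ≐ Span v
  basis {zero}  v = zero , v , (λ _ _ ()) , (λ x → x) , λ x → x
  basis {suc k} {m} v with dichotomy m v
  ... | inj₁ (li , _) = suc k , v , li , (λ x → x) , λ x → x
  ... | inj₂ (a , rel , j , aj≉0) with basis (removeAt v j)
  ...   | r , b , li , b⊆v′ , v′⊆b = r , b , li ,
            Span-least v′ v (λ l → Span-generator v (punchIn j l)) ∘ b⊆v′ ,
            v′⊆b ∘ Span-least v v′ (∀-punchIn j (dependent-member v a j rel aj≉0) (Span-generator v′))
    where
    v′ = removeAt v j

-- Matrices acting on vectors, and the upper bound on the rank.

module Matrices {c ℓ} (F : Field c ℓ) where
  open Field F hiding (zero)
  open LinearAlgebra F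
  open VectorSpaces F
  open SetoidReasoning setoid

  infixr 7 _·_
  -- Linearity is inherited from `lincomb` on the columns. A product such as AGB appears only as
  -- successive actions on a vector.
  _·_ : ∀ {m n} → Matrix m n → Vector Carrier n → Vector Carrier m
  A · x = lincomb x (transpose A)

  infixl 6 _⊞_
  _⊞_ : ∀ {k} → Vector Carrier k → Vector Carrier k → Vector Carrier k
  (x ⊞ y) i = x i + y i

  ·-congˡ : ∀ {m n} (A : Matrix m n) {x y} → x ≋ y → A · x ≋ A · y
  ·-congˡ A x≋y = lincomb-congˡ (transpose A) x≋y

  ·-congʳ : ∀ {m n} {A B : Matrix m n} → (∀ i → A i ≋ B i) → ∀ x → A · x ≋ B · x
  ·-congʳ A≋B x = lincomb-congʳ x λ j i → A≋B i j

  ·-⊞ : ∀ {m n} (A : Matrix m n) x y → A · (x ⊞ y) ≋ A · x ⊞ A · y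
  ·-⊞ A x y = lincomb-+ˡ x y (transpose A)

  ·-lincomb : ∀ {k m n} (A : Matrix m n) (a : Vector Carrier k) v →
              A · lincomb a v ≋ lincomb a λ j → A · v j
  ·-lincomb A a v i = sym (lincomb-lincomb a v (transpose A) i)

  ·-scale : ∀ {m n} (A : Matrix m n) s x i → (A · λ j → s * x j) i ≈ s * (A · x) i
  ·-scale A s x i = lincomb-scale x s (transpose A) i

  ·-zero : ∀ {m n} (A : Matrix m n) {x} → (∀ j → x j ≈ 0#) → ∀ i → (A · x) i ≈ 0#
  ·-zero A = lincomb-zeroˡ (transpose A)

  -- The image of `A′` lies in the span of the `r` vectors `P ∘ b`, so the exchange lemma applies.
  -- With maps `P` and `Q`, the outer factors of the factorisation need not be formed as matrices.
  rank-monotone : ∀ {m n r s} (A A′ : Matrix m n) (P : Vector Carrier m → Vector Carrier m)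
    (Q : Vector Carrier n → Vector Carrier n) →
    (∀ {x y} → x ≋ y → P x ≋ P y) →
    (∀ {k} (a : Vector Carrier k) v → P (lincomb a v) ≋ lincomb a (P ∘ v)) →
    (∀ x → A′ · x ≋ P (A · Q x)) →
    HasRank A r → HasRank A′ s → s ℕ.≤ r
  rank-monotone A A′ P Q P-cong P-lincomb A′≋PAQ (b , _ , _ , A⊆b) (b′ , b′-li , b′⊆A′ , _) =
    steinitz b′ (P ∘ b) b′-li member
    where
    member : ∀ j → Span (P ∘ b) (b′ j)
    member j with b′⊆A′ (Span-generator b′ j)
    ... | x , b′j≋A′x with A⊆b (Q x , λ _ → refl)
    ...   | a , AQx≋ab = a , λ i → begin
            b′ j i                  ≈⟨ b′j≋A′x i ⟩
            (A′ · x) i              ≈⟨ A′≋PAQ x i ⟩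
            P (A · Q x) i           ≈⟨ P-cong AQx≋ab i ⟩
            P (lincomb a b) i       ≈⟨ P-lincomb a b i ⟩
            lincomb a (P ∘ b) i     ∎

  -- B x and B y are multiples of one vector, so if f and g agree on a nonzero multiple of it
  -- they agree on all of them.
  rank-one : ∀ {m} (B : Matrix m m) → HasRank B 1 → (f g : Vector Carrier m → Carrier) →
    (∀ s x y → (∀ i → y i ≈ s * x i) → f y ≈ s * f x) →
    (∀ s x y → (∀ i → y i ≈ s * x i) → g y ≈ s * g x) →
    ∀ x y → ¬ f (B · x) ≈ g (B · x) → f (B · y) ≈ g (B · y) → ∀ i → (B · y) i ≈ 0#
  rank-one B (b , _ , _ , B⊆b) f g f-scale g-scale x y fBx≉gBx fBy≈gBy i with B⊆b (y , λ _ → refl)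
  ... | a , By≋ with a zero ≟ 0#
  ...   | yes a≈0 = begin
            (B · y) i           ≈⟨ By≋ i ⟩
            a zero * b zero i + 0# ≈⟨ +-identityʳ _ ⟩
            a zero * b zero i   ≈⟨ *-congʳ a≈0 ⟩
            0# * b zero i       ≈⟨ zeroˡ _ ⟩
            0#                  ∎
  ...   | no a≉0 with B⊆b (x , λ _ → refl)
  ...     | d , Bx≋ = contradiction agree fBx≉gBx
    where
    drop : ∀ {z} (e : Vector Carrier 1) → z ≋ lincomb e b → ∀ i → z i ≈ e zero * b zero i
    drop e z≋ i = trans (z≋ i) (+-identityʳ _)

    agree : f (B · x) ≈ g (B · x)
    agree = begin
      f (B · x)             ≈⟨ f-scale (d zero) (b zero) _ (drop d Bx≋) ⟩
      d zero * f (b zero)   ≈⟨ *-congˡ (*-cancelˡ a≉0 (begin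
        a zero * f (b zero)   ≈⟨ f-scale (a zero) (b zero) _ (drop a By≋) ⟨
        f (B · y)             ≈⟨ fBy≈gBy ⟩
        g (B · y)             ≈⟨ g-scale (a zero) (b zero) _ (drop a By≋) ⟩
        a zero * g (b zero)   ∎)) ⟩
      d zero * g (b zero)   ≈⟨ g-scale (d zero) (b zero) _ (drop d Bx≋) ⟨
      g (B · x)             ∎

  row-functional-scale : ∀ {m n} (A : Matrix m n) i s x y →
    (∀ j → y j ≈ s * x j) → (A · y) i ≈ s * (A · x) i
  row-functional-scale A i s x y y≈sx = trans (·-congˡ A y≈sx i) (·-scale A s x i)

  row-functional-scale₂ : ∀ {l m n} (A : Matrix l m) (B : Matrix m n) i s x y →
    (∀ j → y j ≈ s * x j) → (A · B · y) i ≈ s * (A · B · x) i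
  row-functional-scale₂ A B i s x y y≈sx =
    row-functional-scale A i s (B · x) (B · y) λ j → row-functional-scale B j s x y y≈sx

  module _ {m n} (B₀ : Matrix m m) (B : Vector (Matrix m m) n) where

    completion-cong : ∀ {α β} → α ≋ β → ∀ i → completion B₀ B α i ≋ completion B₀ B β i
    completion-cong α≋β i j = +-congˡ (sum-cong-≋ λ k → *-congʳ (α≋β k))

    completion-· : ∀ α x → completion B₀ B α · x ≋ B₀ · x ⊞ lincomb α (λ k → B k · x)
    completion-· α x i = begin
      lincomb x (λ j i → B₀ i j + lincomb α (λ k i → B k i j) i) i
        ≈⟨ lincomb-+ʳ x (transpose B₀) (λ j → lincomb α (λ k → transpose (B k) j)) i ⟩
      (B₀ · x) i + lincomb x (λ j → lincomb α (λ k → transpose (B k) j)) i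
        ≈⟨ +-congˡ (lincomb-swap x α (λ j k → transpose (B k) j) i) ⟩
      (B₀ · x) i + lincomb α (λ k → B k · x) i ∎

    completion-shift : ∀ α β x →
      completion B₀ B β · x ≋ completion B₀ B α · x ⊞ lincomb (λ k → β k - α k) (λ k → B k · x)
    completion-shift α β x i = begin
      (completion B₀ B β · x) i                                ≈⟨ completion-· β x i ⟩
      (B₀ · x) i + lincomb β Bx i
        ≈⟨ +-congˡ (lincomb-congˡ Bx (λ k → x+[y-x]≈y (α k) (β k)) i) ⟨
      (B₀ · x) i + lincomb (λ k → α k + (β k - α k)) Bx i      ≈⟨ +-congˡ (lincomb-+ˡ α _ Bx i) ⟩
      (B₀ · x) i + (lincomb α Bx i + lincomb _ Bx i)           ≈⟨ +-assoc _ _ _ ⟨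
      (B₀ · x) i + lincomb α Bx i + lincomb _ Bx i             ≈⟨ +-congʳ (completion-· α x i) ⟨
      (completion B₀ B α · x) i + lincomb _ Bx i               ∎
      where
      Bx = λ k → B k · x

  -- With d = s + n split into its parts on S and off S,
  -- A + Σ d B = (1 + (Σ n B) G) A (1 + G (Σ s B)).
  rank-bound : ∀ {m n} (A A′ G : Matrix m m) (B : Vector (Matrix m m) n) (d : Vector Carrier n)
    (S : Fin n → Set) (S? : ∀ k → Dec (S k)) →
    (∀ x → A′ · x ≋ A · x ⊞ lincomb d (λ k → B k · x)) →
    (∀ k → S k → ∀ x → A · G · B k · x ≋ B k · x) →
    (∀ k → ¬ S k → ∀ x → B k · G · A · x ≋ B k · x) →
    (∀ k l → S k → ¬ S l → ∀ x i → (B l · G · B k · x) i ≈ 0#) →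
    ∀ {r s} → HasRank A r → HasRank A′ s → s ℕ.≤ r
  rank-bound {m} {n} A A′ G B d S S? A′· inS offS acrossS =
    rank-monotone A A′ P Q P-cong P-lincomb factor
    where
    dS dN : Vector Carrier n
    dS k with S? k
    ... | yes _ = d k
    ... | no  _ = 0#
    dN k with S? k
    ... | yes _ = 0#
    ... | no  _ = d k

    dS+dN : ∀ k → dS k + dN k ≈ d k
    dS+dN k with S? k
    ... | yes _ = +-identityʳ (d k)
    ... | no  _ = +-identityˡ (d k)

    dS-support : ∀ k → dS k ≈ 0# ⊎ S k
    dS-support k with S? k
    ... | yes k∈S = inj₂ k∈S
    ... | no  _   = inj₁ refl

    dN-support : ∀ k → dN k ≈ 0# ⊎ ¬ S k
    dN-support k with S? k
    ... | yes _   = inj₁ refl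
    ... | no  k∉S = inj₂ k∉S

    P Q T : Vector Carrier m → Vector Carrier m
    P y = y ⊞ lincomb dN λ k → B k · G · y
    T x = lincomb dS λ k → B k · x
    Q x = x ⊞ G · T x

    P-cong : ∀ {x y} → x ≋ y → P x ≋ P y
    P-cong x≋y i = +-cong (x≋y i) (lincomb-congʳ dN (λ k → ·-congˡ (B k) (·-congˡ G x≋y)) i)

    P-lincomb : ∀ {k} (a : Vector Carrier k) v → P (lincomb a v) ≋ lincomb a (P ∘ v)
    P-lincomb a v i = begin
      lincomb a v i + lincomb dN (λ k → B k · G · lincomb a v) i
        ≈⟨ +-congˡ (lincomb-congʳ dN (λ k → BG-lincomb k) i) ⟩
      lincomb a v i + lincomb dN (λ k → lincomb a λ j → B k · G · v j) i
        ≈⟨ +-congˡ (lincomb-swap dN a (λ k j → B k · G · v j) i) ⟩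
      lincomb a v i + lincomb a (λ j → lincomb dN λ k → B k · G · v j) i
        ≈⟨ lincomb-+ʳ a v (λ j → lincomb dN λ k → B k · G · v j) i ⟨
      lincomb a (P ∘ v) i ∎
      where
      BG-lincomb : ∀ k → B k · G · lincomb a v ≋ lincomb a λ j → B k · G · v j
      BG-lincomb k i = trans (·-congˡ (B k) (·-lincomb G a v) i) (·-lincomb (B k) a (λ j → G · v j) i)

    -- `T` involves only indices in `S`, and there AGB = B, so `A · G · T x` collapses to `T x`.
    AQ : ∀ x → A · Q x ≋ A · x ⊞ T x
    AQ x i = begin
      (A · Q x) i                                       ≈⟨ ·-⊞ A x (G · T x) i ⟩
      (A · x) i + (A · G · T x) i                       ≈⟨ +-congˡ (·-congˡ A (·-lincomb G dS (λ k → B k · x)) i) ⟩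
      (A · x) i + (A · lincomb dS λ k → G · B k · x) i  ≈⟨ +-congˡ (·-lincomb A dS (λ k → G · B k · x) i) ⟩
      (A · x) i + lincomb dS (λ k → A · G · B k · x) i
        ≈⟨ +-congˡ (lincomb-cong-support dS (λ k → map₂ (λ k∈S → inS k k∈S x) (dS-support k)) i) ⟩
      (A · x) i + T x i                                 ∎

    BGT : ∀ l → ¬ S l → ∀ x i → (B l · G · T x) i ≈ 0#
    BGT l l∉S x i = begin
      (B l · G · T x) i                          ≈⟨ ·-congˡ (B l) (·-lincomb G dS (λ k → B k · x)) i ⟩
      (B l · lincomb dS λ k → G · B k · x) i     ≈⟨ ·-lincomb (B l) dS (λ k → G · B k · x) i ⟩
      lincomb dS (λ k → B l · G · B k · x) i
        ≈⟨ lincomb-cong-support dS {w = λ _ _ → 0#} (λ k → map₂ (λ k∈S → acrossS k l k∈S l∉S x) (dS-support k)) i ⟩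
      lincomb dS (λ _ _ → 0#) i                  ≈⟨ lincomb-zero dS (λ _ (_ : Fin m) → refl) i ⟩
      0#                                         ∎

    -- No edge leaves `S`, so the summand `T x` of `A · Q x` is invisible to `B l · G` for `l` off
    -- `S`. Therefore `P` adds exactly the terms of `d` off `S`.
    BGAQ : ∀ l → ¬ S l → ∀ x → B l · G · A · Q x ≋ B l · x
    BGAQ l l∉S x i = begin
      (B l · G · A · Q x) i                      ≈⟨ ·-congˡ (B l) (·-congˡ G (AQ x)) i ⟩
      (B l · G · (A · x ⊞ T x)) i                ≈⟨ ·-congˡ (B l) (·-⊞ G (A · x) (T x)) i ⟩
      (B l · (G · A · x ⊞ G · T x)) i            ≈⟨ ·-⊞ (B l) (G · A · x) (G · T x) i ⟩
      (B l · G · A · x) i + (B l · G · T x) i    ≈⟨ +-cong (offS l l∉S x i) (BGT l l∉S x i) ⟩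
      (B l · x) i + 0#                           ≈⟨ +-identityʳ _ ⟩
      (B l · x) i                                ∎

    factor : ∀ x → A′ · x ≋ P (A · Q x)
    factor x i = begin
      (A′ · x) i                                                     ≈⟨ A′· x i ⟩
      (A · x) i + lincomb d Bx i                                     ≈⟨ +-congˡ (lincomb-congˡ Bx dS+dN i) ⟨
      (A · x) i + lincomb (λ k → dS k + dN k) Bx i                   ≈⟨ +-congˡ (lincomb-+ˡ dS dN Bx i) ⟩
      (A · x) i + (T x i + lincomb dN Bx i)                          ≈⟨ +-assoc _ _ _ ⟨
      (A · x) i + T x i + lincomb dN Bx i                            ≈⟨ +-cong (AQ x i)
        (lincomb-cong-support dN (λ k → map₂ (λ k∉S → BGAQ k k∉S x) (dN-support k)) i) ⟨
      P (A · Q x) i                                                  ∎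
      where
      Bx = λ k → B k · x

-- Augmentation: flipping along a shortest path shrinks the kernel.

module Augmentation {c ℓ} (F : Field c ℓ) where
  open Field F hiding (zero)
  open LinearAlgebra F
  open VectorSpaces F
  open Matrices F
  open SetoidReasoning setoid

  module Kernel {m n} (A A′ G : Matrix m m) (B : Vector (Matrix m m) n) (d : Vector Carrier n)
    (B-rank : ∀ k → HasRank (B k) 1)
    (A′· : ∀ x → A′ · x ≋ A · x ⊞ lincomb d (λ k → B k · x))
    (AGA : ∀ x → A · G · A · x ≋ A · x)
    {Source Sink : Fin n → Set} {Edge : Fin n → Fin n → Set}
    {source? : ∀ k → Dec (Source k)} {sink? : ∀ k → Dec (Sink k)}
    {edge? : ∀ k l → Dec (Edge k l)}
    (source⁺ : ∀ k → Source k → ∃₂ λ x i → ¬ (B k · G · A · x) i ≈ (B k · x) i)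
    (source⁻ : ∀ k → ¬ Source k → ∀ x → B k · G · A · x ≋ B k · x)
    (sink⁺ : ∀ k → Sink k → ∃₂ λ x i → ¬ (A · G · B k · x) i ≈ (B k · x) i)
    (sink⁻ : ∀ k → ¬ Sink k → ∀ x → A · G · B k · x ≋ B k · x)
    (edge⁺ : ∀ k l → Edge k l → ∃₂ λ x i → ¬ (B l · G · B k · x) i ≈ 0#)
    (edge⁻ : ∀ k l → ¬ Edge k l → ∀ x i → (B l · G · B k · x) i ≈ 0#)
    where
    open ShortestPath Source Sink Edge source? sink? edge?

    module _ (x : Vector Carrier m) (A′x≈0 : ∀ i → (A′ · x) i ≈ 0#) where

      Ax+dBx≈0 : ∀ i → (A · x) i + lincomb d (λ k → B k · x) i ≈ 0#
      Ax+dBx≈0 i = trans (sym (A′· x i)) (A′x≈0 i)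

      -- `M · G` applied to the relation A′x = 0. The choice `M = A` treats the sink, and `M = B j`
      -- treats an edge into `j`.
      image≈0 : ∀ (M : Matrix m m) i → (M · G · A · x) i + lincomb d (λ k → M · G · B k · x) i ≈ 0#
      image≈0 M i = begin
        (M · G · A · x) i + lincomb d (λ k → M · G · B k · x) i      ≈⟨ +-congˡ (·-lincomb M d (λ k → G · B k · x) i) ⟨
        (M · G · A · x) i + (M · lincomb d λ k → G · B k · x) i
          ≈⟨ +-congˡ (·-congˡ M (·-lincomb G d (λ k → B k · x)) i) ⟨
        (M · G · A · x) i + (M · G · lincomb d λ k → B k · x) i      ≈⟨ ·-⊞ M (G · A · x) _ i ⟨
        (M · (G · A · x ⊞ G · lincomb d λ k → B k · x)) i            ≈⟨ ·-congˡ M (·-⊞ G (A · x) _) i ⟨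
        (M · G · (A · x ⊞ lincomb d λ k → B k · x)) i                ≈⟨ ·-zero M (·-zero G Ax+dBx≈0) i ⟩
        0#                                                           ∎

      -- Follow the path backwards from its sink: the nodes already treated do not act on x,
      -- and by minimality the remaining ones have no edge to the current node.
      path-kernel : ∀ {t k} (p : Path t k) →
        (∀ l → d l ≈ 0# ⊎ l ∈ p ⊎ ¬ Reach t l) → (∀ l → l ∈ p → ¬ d l ≈ 0#) →
        ∀ l → l ∈ p → ∀ i → (B l · x) i ≈ 0#
      path-kernel {k = k} (stop sink) support d≉0 .k ≡.refl with sink⁺ k sink
      ... | y , i , differ =
        rank-one (B k) (B-rank k) (λ v → (A · G · v) i) (λ v → v i)
          (row-functional-scale₂ A G i) (λ s u v v≈su → v≈su i) y x differ
          (*-cancelˡ (d≉0 k ≡.refl) (sum-agree _ _ k others sums))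
        where
        others : ∀ l → l ≢ k → d l * (A · G · B l · x) i ≈ d l * (B l · x) i
        others l l≢k with support l
        ... | inj₁ dl≈0          = trans (trans (*-congʳ dl≈0) (zeroˡ _)) (sym (trans (*-congʳ dl≈0) (zeroˡ _)))
        ... | inj₂ (inj₁ l≡k)    = contradiction l≡k l≢k
        -- `Reach 0` is `Sink`: the earlier nodes of the path fall under this case, as minimality
        -- keeps them from being sinks.
        ... | inj₂ (inj₂ ¬sink)  = *-congˡ (sink⁻ l ¬sink x i)

        -- AG applied to A′x = 0 keeps the summand Ax, since AGA = A; comparison with A′x = 0 itself
        -- leaves the two sums.
        sums : lincomb d (λ l → A · G · B l · x) i ≈ lincomb d (λ l → B l · x) i
        sums = +-cancelˡ ((A · x) i) _ _ (begin
          (A · x) i + lincomb d (λ l → A · G · B l · x) i          ≈⟨ +-congʳ (AGA x i) ⟨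
          (A · G · A · x) i + lincomb d (λ l → A · G · B l · x) i  ≈⟨ image≈0 A i ⟩
          0#                                                       ≈⟨ Ax+dBx≈0 i ⟨
          (A · x) i + lincomb d (λ l → B l · x) i                  ∎)
      path-kernel {suc t} (skip p) support d≉0 = path-kernel p support′ d≉0
        where
        support′ : ∀ l → d l ≈ 0# ⊎ l ∈ p ⊎ ¬ Reach t l
        support′ l = map₂ (map₂ (_∘ inj₁)) (support l)
      path-kernel {suc t} {k} (step {j = j} edge ¬reach ¬source p) support d≉0 = result
        where
        support′ : ∀ l → d l ≈ 0# ⊎ l ∈ p ⊎ ¬ Reach t l
        support′ l with support l
        ... | inj₁ dl≈0                  = inj₁ dl≈0
        -- For the tail, `k` joins the nodes that are too far from the sinks; the support condition
        -- admits such nodes for this purpose.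
        ... | inj₂ (inj₁ (inj₁ ≡.refl))  = inj₂ (inj₂ ¬reach)
        ... | inj₂ (inj₁ (inj₂ l∈p))     = inj₂ (inj₁ l∈p)
        ... | inj₂ (inj₂ ¬r)             = inj₂ (inj₂ (¬r ∘ inj₁))

        tail : ∀ l → l ∈ p → ∀ i → (B l · x) i ≈ 0#
        tail = path-kernel p support′ λ l → d≉0 l ∘ inj₂

        others : ∀ i l → l ≢ k → d l * (B j · G · B l · x) i ≈ 0#
        others i l l≢k with support l
        ... | inj₁ dl≈0               = trans (*-congʳ dl≈0) (zeroˡ _)
        ... | inj₂ (inj₁ (inj₁ l≡k))  = contradiction l≡k l≢k
        ... | inj₂ (inj₁ (inj₂ l∈p))  = trans (*-congˡ (·-zero (B j) (·-zero G (tail l l∈p)) i)) (zeroʳ _)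
        -- An edge from `l` to `j` would bring `l` within `suc t` edges of a sink.
        ... | inj₂ (inj₂ ¬r)          = trans (*-congˡ (edge⁻ l j (λ e → ¬r (inj₂ (j , e , path⇒reach p))) x i)) (zeroʳ _)

        -- Since `j` is not a source, `B j · G · A · x` is `B j · x`, which is already zero by the
        -- tail. Only the term of `k` survives.
        d*BGB≈0 : ∀ i → d k * (B j · G · B k · x) i ≈ d k * 0#
        d*BGB≈0 i = begin
          d k * (B j · G · B k · x) i                                  ≈⟨ sum-single _ k (others i) ⟨
          lincomb d (λ l → B j · G · B l · x) i                        ≈⟨ +-identityˡ _ ⟨
          0# + lincomb d (λ l → B j · G · B l · x) i
            ≈⟨ +-congʳ (trans (source⁻ j ¬source x i) (tail j (start∈ p) i)) ⟨
          (B j · G · A · x) i + lincomb d (λ l → B j · G · B l · x) i  ≈⟨ image≈0 (B j) i ⟩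
          0#                                                           ≈⟨ zeroʳ (d k) ⟨
          d k * 0#                                                     ∎

        result : ∀ l → l ≡ k ⊎ l ∈ p → ∀ i → (B l · x) i ≈ 0#
        result l (inj₂ l∈p)    = tail l l∈p
        result l (inj₁ ≡.refl) with edge⁺ k j edge
        ... | y , i , nonzero =
          rank-one (B k) (B-rank k) (λ v → (B j · G · v) i) (λ _ → 0#)
            (row-functional-scale₂ (B j) G i) (λ s _ _ _ → sym (zeroʳ s)) y x nonzero
            (*-cancelˡ (d≉0 k (inj₁ ≡.refl)) (d*BGB≈0 i))

    module _ {t k} (source : Source k) (p : Path t k)
      (off-path : ∀ l → ¬ l ∈ p → d l ≈ 0#) (on-path : ∀ l → l ∈ p → ¬ d l ≈ 0#) where

      on-path-kernel : ∀ x → (∀ i → (A′ · x) i ≈ 0#) → ∀ l → l ∈ p → ∀ i → (B l · x) i ≈ 0#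
      on-path-kernel x A′x≈0 = path-kernel x A′x≈0 p support on-path
        where
        support : ∀ l → d l ≈ 0# ⊎ l ∈ p ⊎ ¬ Reach t l
        support l with l ∈? p
        ... | yes l∈p = inj₂ (inj₁ l∈p)
        ... | no  l∉p = inj₁ (off-path l l∉p)

      kernel-shrinks : ∀ x → (∀ i → (A′ · x) i ≈ 0#) → ∀ i → (A · x) i ≈ 0#
      kernel-shrinks x A′x≈0 i = begin
        (A · x) i                                       ≈⟨ +-identityʳ _ ⟨
        (A · x) i + 0#                                  ≈⟨ +-congˡ (sum-zero _ term) ⟨
        (A · x) i + lincomb d (λ l → B l · x) i         ≈⟨ Ax+dBx≈0 x A′x≈0 i ⟩
        0#                                              ∎
        where
        term : ∀ l → d l * (B l · x) i ≈ 0#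
        term l with l ∈? p
        ... | yes l∈p = trans (*-congˡ (on-path-kernel x A′x≈0 l l∈p i)) (zeroʳ _)
        ... | no  l∉p = trans (*-congʳ (off-path l l∉p)) (zeroˡ _)

      -- For w = GAy - y, AGA = A gives Aw = 0, while `B k` sends w to BGAy - By, which is nonzero
      -- for a suitable y because `k` is a source. If A′ killed w, so would `B k`, as `k` lies on
      -- the path.
      kernel-witness : ∃ λ w → (∀ i → (A · w) i ≈ 0#) × ¬ (∀ i → (A′ · w) i ≈ 0#)
      kernel-witness with source⁺ k source
      ... | y , i , differ = w , Aw≈0 , λ A′w≈0 → differ (x-y≈0⇒x≈y
              (trans (sym (M·w (B k) i)) (on-path-kernel w A′w≈0 k (start∈ p) i)))
        where
        w : Vector Carrier m
        w = G · A · y ⊞ λ j → - 1# * y j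

        x-y≈0⇒x≈y : ∀ {x y} → x + - 1# * y ≈ 0# → x ≈ y
        x-y≈0⇒x≈y {x} {y} eq = x∙y⁻¹≈ε⇒x≈y x y (trans (+-congˡ (sym (-1*x≈-x y))) eq)

        M·w : ∀ (M : Matrix m m) i → (M · w) i ≈ (M · G · A · y) i + - 1# * (M · y) i
        M·w M i = trans (·-⊞ M (G · A · y) _ i) (+-congˡ (·-scale M (- 1#) y i))

        Aw≈0 : ∀ i → (A · w) i ≈ 0#
        Aw≈0 i = begin
          (A · w) i                                ≈⟨ M·w A i ⟩
          (A · G · A · y) i + - 1# * (A · y) i     ≈⟨ +-cong (AGA y i) (-1*x≈-x _) ⟩
          (A · y) i - (A · y) i                    ≈⟨ -‿inverseʳ _ ⟩
          0#                                       ∎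

  -- A combination killed by `A′` is killed by `A`. Under `A` the vector `w` disappears, so the
  -- coefficients of `ws` vanish, and a multiple of `A′ · w` remains.
  independent-extend : ∀ {m t} (A A′ : Matrix m m) (ws : Vector (Vector Carrier m) t) w →
    LinearlyIndependent (λ j → A · ws j) →
    (∀ x → (∀ i → (A′ · x) i ≈ 0#) → ∀ i → (A · x) i ≈ 0#) →
    (∀ i → (A · w) i ≈ 0#) → ¬ (∀ i → (A′ · w) i ≈ 0#) →
    LinearlyIndependent λ j → A′ · (w ∷ ws) j
  independent-extend {m} {t} A A′ ws w li shrinks Aw≈0 A′w≉0 a rel = λ { zero → a₀≈0 ; (suc j) → rest≈0 j }
    where
    lincomb-A′ : ∀ i → (A′ · lincomb a (w ∷ ws)) i ≈ 0#
    lincomb-A′ i = trans (·-lincomb A′ a (w ∷ ws) i) (rel i)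

    rest≈0 : ∀ j → a (suc j) ≈ 0#
    rest≈0 = li (a ∘ suc) λ i → begin
      lincomb (a ∘ suc) (λ j → A · ws j) i                              ≈⟨ +-identityˡ _ ⟨
      0# + lincomb (a ∘ suc) (λ j → A · ws j) i                         ≈⟨ +-congʳ (trans (*-congˡ (Aw≈0 i)) (zeroʳ _)) ⟨
      a zero * (A · w) i + lincomb (a ∘ suc) (λ j → A · ws j) i         ≈⟨ ·-lincomb A a (w ∷ ws) i ⟨
      (A · lincomb a (w ∷ ws)) i                                        ≈⟨ shrinks _ lincomb-A′ i ⟩
      0#                                                                ∎

    a₀≈0 : a zero ≈ 0#
    a₀≈0 with a zero ≟ 0#
    ... | yes eq = eq
    ... | no a₀≉0 = contradiction (λ i → *-cancelˡ a₀≉0 (begin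
      a zero * (A′ · w) i                                                 ≈⟨ +-identityʳ _ ⟨
      a zero * (A′ · w) i + 0#
        ≈⟨ +-congˡ (lincomb-zeroˡ (λ j → A′ · ws j) rest≈0 i) ⟨
      a zero * (A′ · w) i + lincomb (a ∘ suc) (λ j → A′ · ws j) i         ≈⟨ rel i ⟩
      0#                                                                  ≈⟨ zeroʳ _ ⟨
      a zero * 0#                                                         ∎)) A′w≉0

  -- Computing G with AGA = A by pivoting.

  RowDone : ∀ {m} → Matrix m m → Matrix m m → Fin m → Set ℓ
  RowDone A G i = ∀ j → A i j ≈ (A · G · transpose A j) i

  -- With R = A - AGA, passing from G to G′ turns R into R - R e_q (e_pᵀ R) / R_pq: one step of
  -- Gaussian elimination, which clears row p of R and keeps rows that are already zero.
  module Pivot {m} (A G : Matrix m m) (p q : Fin m) where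

    pivot : Carrier
    pivot = A p q - (A · G · transpose A q) p

    -- Chosen so that Aw is column `q` of R divided by the pivot and yᵀA is row `p` of R. Adding w
    -- yᵀ to G therefore adds R e_q (e_pᵀ R) / R_pq to AGA.
    w y : Vector Carrier m
    w i = (unit q i - (G · transpose A q) i) * pivot ⁻¹
    y j = unit p j - (A · transpose G j) p

    G′ : Matrix m m
    G′ i j = G i j + w i * y j

    module _ (pivot≉0 : ¬ pivot ≈ 0#) where

      ·-unit : (M : Matrix m m) → ∀ j → M · unit j ≋ transpose M j
      ·-unit M j = lincomb-unit j (transpose M)

      neg : Vector Carrier m → Vector Carrier m
      neg v i = - 1# * v i

      A·w : ∀ i → (A · w) i ≈ (A i q - (A · G · transpose A q) i) * pivot ⁻¹
      A·w i = begin
        (A · w) i                                                    ≈⟨ ·-congˡ A (λ j → *-comm _ (pivot ⁻¹)) i ⟩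
        (A · λ j → pivot ⁻¹ * (unit q j - (G · Aq) j)) i             ≈⟨ ·-scale A (pivot ⁻¹) _ i ⟩
        pivot ⁻¹ * (A · λ j → unit q j - (G · Aq) j) i               ≈⟨ *-comm (pivot ⁻¹) _ ⟩
        (A · λ j → unit q j - (G · Aq) j) i * pivot ⁻¹               ≈⟨ *-congʳ (·-congˡ A (λ j → +-congˡ (-1*x≈-x _)) i) ⟨
        (A · (unit q ⊞ neg (G · Aq))) i * pivot ⁻¹                   ≈⟨ *-congʳ (·-⊞ A (unit q) (neg (G · Aq)) i) ⟩
        ((A · unit q) i + (A · neg (G · Aq)) i) * pivot ⁻¹
          ≈⟨ *-congʳ (+-cong (·-unit A q i) (trans (·-scale A (- 1#) (G · Aq) i) (-1*x≈-x _))) ⟩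
        (A i q - (A · G · Aq) i) * pivot ⁻¹                          ∎
        where
        Aq = transpose A q

      y·_ : Vector Carrier m → Carrier
      y· x = sum λ s → x s * y s

      y·≈ : ∀ x → y· x ≈ x p - (A · G · x) p
      y·≈ x = begin
        sum (λ s → x s * (unit p s - AG s))                    ≈⟨ sum-cong-≋ (λ s → *-congˡ (+-congˡ (-1*x≈-x (AG s)))) ⟨
        lincomb x (λ s _ → unit p s + - 1# * AG s) p           ≈⟨ lincomb-+ʳ x (λ s _ → unit p s) (λ s _ → - 1# * AG s) p ⟩
        sum (λ s → x s * unit p s) + sum (λ s → x s * (- 1# * AG s))
          ≈⟨ +-cong (sum-cong-≋ λ s → *-comm (x s) (unit p s)) (sum-cong-≋ λ s → negate (x s) (AG s)) ⟩
        lincomb (unit p) (λ s _ → x s) p + sum (λ s → - 1# * (x s * AG s))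
          ≈⟨ +-cong (lincomb-unit p (λ s _ → x s) p) (sym (*-distribˡ-sum (- 1#) (λ s → x s * AG s))) ⟩
        x p + - 1# * lincomb x (λ s → A · transpose G s) p     ≈⟨ +-congˡ (-1*x≈-x _) ⟩
        x p - lincomb x (λ s → A · transpose G s) p            ≈⟨ +-congˡ (-‿cong (·-lincomb A x (transpose G) p)) ⟨
        x p - (A · G · x) p                                    ∎
        where
        AG : Vector Carrier m
        AG s = (A · transpose G s) p

        negate : ∀ a b → a * (- 1# * b) ≈ - 1# * (a * b)
        negate a b = begin
          a * (- 1# * b)   ≈⟨ *-assoc a (- 1#) b ⟨
          a * - 1# * b     ≈⟨ *-congʳ (*-comm a (- 1#)) ⟩
          - 1# * a * b     ≈⟨ *-assoc (- 1#) a b ⟩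
          - 1# * (a * b)   ∎

      A·G′· : ∀ x i → (A · G′ · x) i ≈ (A · G · x) i + y· x * (A · w) i
      A·G′· x i = begin
        (A · G′ · x) i                                 ≈⟨ ·-congˡ A G′· i ⟩
        (A · (G · x ⊞ λ j → y· x * w j)) i             ≈⟨ ·-⊞ A (G · x) _ i ⟩
        (A · G · x) i + (A · λ j → y· x * w j) i       ≈⟨ +-congˡ (·-scale A (y· x) w i) ⟩
        (A · G · x) i + y· x * (A · w) i               ∎
        where
        G′· : G′ · x ≋ G · x ⊞ λ j → y· x * w j
        G′· j = begin
          (G′ · x) j                                   ≈⟨ lincomb-+ʳ x (transpose G) (λ s i → w i * y s) j ⟩
          (G · x) j + sum (λ s → x s * (w j * y s))
            ≈⟨ +-congˡ (sum-cong-≋ λ s → trans (*-congˡ (*-comm (w j) (y s))) (sym (*-assoc (x s) (y s) (w j)))) ⟩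
          (G · x) j + sum (λ s → x s * y s * w j)      ≈⟨ +-congˡ (*-distribʳ-sum (w j) (λ s → x s * y s)) ⟨
          (G · x) j + y· x * w j                       ∎

      -- A finished row of R is zero also in column `q`, so `A · w` vanishes at `i`.
      keeps-rows : ∀ i → RowDone A G i → RowDone A G′ i
      keeps-rows i done j = sym (begin
        (A · G′ · transpose A j) i                                            ≈⟨ A·G′· _ i ⟩
        (A · G · transpose A j) i + y· (transpose A j) * (A · w) i            ≈⟨ +-cong (sym (done j)) (*-congˡ (A·w i)) ⟩
        A i j + y· (transpose A j) * ((A i q - (A · G · transpose A q) i) * pivot ⁻¹)
          ≈⟨ +-congˡ (*-congˡ (*-congʳ (trans (+-congʳ (done q)) (-‿inverseʳ _)))) ⟩
        A i j + y· (transpose A j) * (0# * pivot ⁻¹)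
          ≈⟨ +-congˡ (trans (*-congˡ (zeroˡ _)) (zeroʳ _)) ⟩
        A i j + 0#                                                            ≈⟨ +-identityʳ _ ⟩
        A i j                                                                 ∎)

      -- `A · w` is 1 at `p`, so the correction is the whole of row `p` of R.
      new-row : RowDone A G′ p
      new-row j = sym (begin
        (A · G′ · transpose A j) p                                            ≈⟨ A·G′· _ p ⟩
        (A · G · transpose A j) p + y· (transpose A j) * (A · w) p
          ≈⟨ +-congˡ (*-cong (y·≈ (transpose A j)) (trans (A·w p) (⁻¹-inverse pivot≉0))) ⟩
        (A · G · transpose A j) p + (A p j - (A · G · transpose A j) p) * 1#  ≈⟨ +-congˡ (*-identityʳ _) ⟩
        (A · G · transpose A j) p + (A p j - (A · G · transpose A j) p)       ≈⟨ x+[y-x]≈y _ _ ⟩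
        A p j                                                                 ∎)

-- Expressions and programs compiled to computation trees.

module Programs (m n : ℕ) where

  ⟨_⟩ : Polynomial₂ → ℕ
  ⟨ p ⟩ = evalPoly p m n

  data Operator : Set where
    plus minus times over : Operator

  -- Expressions are indexed by the number of instructions they compile to.
  data Expr (V : Set) : Polynomial₂ → Set where
    var : V → Expr V (con 0)
    bit : Bool → Expr V (con 1)
    op  : ∀ {s t} → Operator → Expr V s → Expr V t → Expr V (con 1 ⊕ (s ⊕ t))
    -- The length is a polynomial because it enters the size: one instruction for the initial 0, and
    -- one addition per term.
    ∑   : ∀ {s} N → (Fin ⟨ N ⟩ → Expr V s) → Expr V (con 1 ⊕ (N ⊗ (con 1 ⊕ s)))

  instruction : ∀ {k} → Operator → Fin k → Fin k → Instruction k
  instruction plus  = add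
  instruction minus = sub
  instruction times = mul
  instruction over  = div

  module _ {r : ℕ} where

    -- Values are known by name, and the argument locates them. Being generic in `k`, a program can
    -- follow any number of instructions.
    Prog : Set → Set
    Prog V = ∀ {k} → (V → Fin k) → Tree r k

    -- The continuation receives the new numbers of the old values and the number of the result.
    Compiler : Set → Set
    Compiler V = ∀ {k} → (V → Fin k) → (∀ {l} → (Fin k → Fin l) → Fin l → Tree r l) → Tree r k

    compileSum : ∀ {V} N → (Fin N → Compiler V) → Compiler V
    compileSum zero    cs ρ κ = compute const0 (κ suc zero)
    compileSum (suc N) cs ρ κ =
      cs zero ρ λ ι x → compileSum N (cs ∘ suc) (ι ∘ ρ) λ ι′ y →
      compute (add (ι′ x) y) (κ (suc ∘ ι′ ∘ ι) zero)

    compile : ∀ {V s} → Expr V s → Compiler V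
    compile (var v)     ρ κ = κ id (ρ v)
    compile (bit true)  ρ κ = compute const1 (κ suc zero)
    compile (bit false) ρ κ = compute const0 (κ suc zero)
    compile (op o e f)  ρ κ =
      compile e ρ λ ι x → compile f (ι ∘ ρ) λ ι′ y →
      compute (instruction o (ι′ x) y) (κ (suc ∘ ι′ ∘ ι) zero)
    compile (∑ N f)         = compileSum ⟨ N ⟩ λ i → compile (f i)

    storeVector : ∀ {V s} N → (Fin N → Expr V s) → ∀ {k} → (V → Fin k) →
                  (∀ {l} → (Fin k → Fin l) → (Fin N → Fin l) → Tree r l) → Tree r k
    storeVector zero    es ρ κ = κ id []
    storeVector (suc N) es ρ κ =
      compile (es zero) ρ λ ι x → storeVector N (es ∘ suc) (ι ∘ ρ) λ ι′ ys →
      κ (ι′ ∘ ι) (ι′ x ∷ ys)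

    -- Copying the continuation into both branches turns outcomes into Booleans that the
    -- construction can inspect. The tree grows exponentially, but only the path taken is charged.
    compareVectors : ∀ {V s t} N → (Fin N → Expr V s) → (Fin N → Expr V t) → ∀ {k} → (V → Fin k) →
                     (∀ {l} → (Fin k → Fin l) → (Fin N → Bool) → Tree r l) → Tree r k
    compareVectors zero    es fs ρ κ = κ id []
    compareVectors (suc N) es fs {k} ρ κ =
      compile (es zero) ρ λ ι x → compile (fs zero) (ι ∘ ρ) λ ι′ y →
      ifEqual (ι′ x) y (continue (ι′ ∘ ι) true) (continue (ι′ ∘ ι) false)
      where
      continue : ∀ {l} → (Fin k → Fin l) → Bool → Tree r l
      continue ι b = compareVectors N (es ∘ suc) (fs ∘ suc) (ι ∘ ρ) λ ι′ bs → κ (ι′ ∘ ι) (b ∷ bs)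

    store : ∀ {V I s N} → Fin N ↔ I → (I → Expr V s) → Prog (V ⊎ I) → Prog V
    store fin es p ρ = storeVector _ (es ∘ Inverse.to fin) ρ λ ι ys → p [ ι ∘ ρ , ys ∘ Inverse.from fin ]

    compare : ∀ {V} {I : Set} {s t N} → Fin N ↔ I → (I → Expr V s) → (I → Expr V t) → ((I → Bool) → Prog V) → Prog V
    compare fin es fs p ρ =
      compareVectors _ (es ∘ Inverse.to fin) (fs ∘ Inverse.to fin) ρ λ ι bs → p (bs ∘ Inverse.from fin) (ι ∘ ρ)

    return : ∀ {V} → (Fin r → V) → Prog V
    return o ρ = output (ρ ∘ o)

    relabel : ∀ {V W} → (W → V) → Prog W → Prog V
    relabel f p ρ = p (ρ ∘ f)

  -- Semantics: values, costs and postconditions of programs.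

  module Semantics {c ℓ} (F : Field c ℓ) where
    open Field F hiding (zero)
    open LinearAlgebra F using (sum)
    open VectorSpaces F using (⁻¹-inverse; *-cancelˡ) renaming (bit to bitValue)
    open Execution F

    apply : Operator → Carrier → Carrier → Carrier
    apply plus  x y = x + y
    apply minus x y = x - y
    apply times x y = x * y
    apply over  x y = x * y ⁻¹

    ⟦_⟧ : ∀ {V s} → Expr V s → (V → Carrier) → Carrier
    ⟦ var v ⟧    σ = σ v
    ⟦ bit b ⟧    σ = bitValue b
    ⟦ op o e f ⟧ σ = apply o (⟦ e ⟧ σ) (⟦ f ⟧ σ)
    ⟦ ∑ N f ⟧    σ = sum λ i → ⟦ f i ⟧ σ

    -- The witness of `inverse` may depend on the representative; uniqueness of inverses restores
    -- compatibility with `_≈_`, up to which all registers are specified.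
    ⁻¹-cong : ∀ {x y} → x ≈ y → x ⁻¹ ≈ y ⁻¹
    ⁻¹-cong {x} {y} x≈y = cases (x ≟ 0#)
      where
      zero-inverse : ∀ {z} → z ≈ 0# → z ⁻¹ ≈ 0#
      zero-inverse {z} z≈0 with z ≟ 0#
      ... | yes _   = refl
      ... | no  z≉0 = contradiction z≈0 z≉0

      cases : Dec (x ≈ 0#) → x ⁻¹ ≈ y ⁻¹
      cases (yes x≈0) = trans (zero-inverse x≈0) (sym (zero-inverse (trans (sym x≈y) x≈0)))
      cases (no  x≉0) = *-cancelˡ x≉0 (trans (⁻¹-inverse x≉0)
        (sym (trans (*-congʳ x≈y) (⁻¹-inverse (x≉0 ∘ trans x≈y)))))

    apply-cong : ∀ o {x x′ y y′} → x ≈ x′ → y ≈ y′ → apply o x y ≈ apply o x′ y′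
    apply-cong plus  x≈ y≈ = +-cong x≈ y≈
    apply-cong minus x≈ y≈ = +-cong x≈ (-‿cong y≈)
    apply-cong times x≈ y≈ = *-cong x≈ y≈
    apply-cong over  x≈ y≈ = *-cong x≈ (⁻¹-cong y≈)

    eval-instruction : ∀ o {k} (i j : Fin k) env → eval (instruction o i j) env ≡ apply o (env i) (env j)
    eval-instruction plus  i j env = ≡.refl
    eval-instruction minus i j env = ≡.refl
    eval-instruction times i j env = ≡.refl
    eval-instruction over  i j env = ≡.refl

    module Hoare {r q} (Q : Vector Carrier r → Set q) where

      record Sat {k} (t : Tree r k) (env : Vector Carrier k) (b : ℕ) : Set q where
        constructor sat
        field
          cost≤ : cost t env ℕ.≤ b
          post  : Q (run t env)

      Sat-weaken : ∀ {k} {t : Tree r k} {env b b′} → b ℕ.≤ b′ → Sat t env b → Sat t env b′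
      Sat-weaken b≤b′ (sat cost≤b post) = sat (ℕ.≤-trans cost≤b b≤b′) post

      Sat-compute : ∀ {k} {e : Instruction k} {t env b} → Sat t (eval e env ∷ env) b → Sat (compute e t) env (suc b)
      Sat-compute (sat cost≤b post) = sat (s≤s cost≤b) post

      Sat-ifEqual : ∀ {k} {i j : Fin k} {t u env b} →
        (env i ≈ env j → Sat t env b) → (¬ env i ≈ env j → Sat u env b) → Sat (ifEqual i j t u) env (suc b)
      Sat-ifEqual {i = i} {j} {t} {u} {env} {b} eq neq = sat (proj₁ both) (proj₂ both)
        where
        both : cost (ifEqual i j t u) env ℕ.≤ suc b × Q (run (ifEqual i j t u) env)
        both with env i ≟ env j
        ... | yes i≈j = s≤s (Sat.cost≤ (eq i≈j)) , Sat.post (eq i≈j)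
        ... | no  i≉j = s≤s (Sat.cost≤ (neq i≉j)) , Sat.post (neq i≉j)

      Meets : ∀ {V} → Prog V → (V → Carrier) → ℕ → Set _
      Meets {V} p σ b = ∀ {k} (ρ : V → Fin k) env → (∀ v → env (ρ v) ≈ σ v) → Sat (p ρ) env b

      -- A correctness triple in continuation style: the budget `a` is paid on top of what the
      -- continuation needs, and old values survive up to `_≈_`.
      Computes : ∀ {V} → Compiler V → (V → Carrier) → Carrier → ℕ → Set _
      Computes {V} C σ x a = ∀ {k} (ρ : V → Fin k) env → (∀ v → env (ρ v) ≈ σ v) →
        ∀ {κ : ∀ {l} → (Fin k → Fin l) → Fin l → Tree r l} {b} →
        (∀ {l} (ι : Fin k → Fin l) y env′ → (∀ i → env′ (ι i) ≈ env i) → env′ y ≈ x → Sat (κ ι y) env′ b) →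
        Sat (C ρ κ) env (a ℕ.+ b)

      compileSum-correct : ∀ {V} N (cs : Fin N → Compiler V) σ xs a →
        (∀ i → Computes (cs i) σ (xs i) a) → Computes (compileSum N cs) σ (sum xs) (1 ℕ.+ N ℕ.* (1 ℕ.+ a))
      compileSum-correct zero    cs σ xs a cs-correct ρ env ρ≈σ k =
        Sat-compute (k suc zero (0# ∷ env) (λ _ → refl) refl)
      compileSum-correct (suc N) cs σ xs a cs-correct ρ env ρ≈σ {κ} {b} k = Sat-weaken (ℕ.≤-reflexive reorder)
        (cs-correct zero ρ env ρ≈σ λ ι x env₁ keep₁ x≈ →
         compileSum-correct N (cs ∘ suc) σ (xs ∘ suc) a (cs-correct ∘ suc) (ι ∘ ρ) env₁
           (λ v → trans (keep₁ (ρ v)) (ρ≈σ v)) λ ι′ y env₂ keep₂ y≈ →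
         Sat-compute (k (suc ∘ ι′ ∘ ι) zero _ (λ i → trans (keep₂ (ι i)) (keep₁ i))
                        (+-cong (trans (keep₂ x) x≈) y≈)))
        where
        reorder : a ℕ.+ ((1 ℕ.+ N ℕ.* (1 ℕ.+ a)) ℕ.+ suc b) ≡ 1 ℕ.+ suc N ℕ.* (1 ℕ.+ a) ℕ.+ b
        reorder = solve 3 (λ a N b → a :+ ((con 1 :+ N :* (con 1 :+ a)) :+ (con 1 :+ b))
                                     := con 1 :+ (con 1 :+ N) :* (con 1 :+ a) :+ b) ≡.refl a N b
          where open +-*-Solver

      compile-correct : ∀ {V s} (e : Expr V s) σ → Computes (compile e) σ (⟦ e ⟧ σ) ⟨ s ⟩
      compile-correct (var v)     σ ρ env ρ≈σ k = k id (ρ v) env (λ _ → refl) (ρ≈σ v)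
      compile-correct (bit true)  σ ρ env ρ≈σ k =
        Sat-compute (k suc zero (1# ∷ env) (λ _ → refl) refl)
      compile-correct (bit false) σ ρ env ρ≈σ k =
        Sat-compute (k suc zero (0# ∷ env) (λ _ → refl) refl)
      compile-correct (∑ N f)     σ = compileSum-correct _ _ σ _ _ λ i → compile-correct (f i) σ
      compile-correct (op {s} {t} o e f) σ ρ env ρ≈σ {κ} {b} k = Sat-weaken (ℕ.≤-reflexive reorder)
        (compile-correct e σ ρ env ρ≈σ λ ι x env₁ keep₁ x≈ →
         compile-correct f σ (ι ∘ ρ) env₁ (λ v → trans (keep₁ (ρ v)) (ρ≈σ v)) λ ι′ y env₂ keep₂ y≈ →
         Sat-compute (k (suc ∘ ι′ ∘ ι) zero _ (λ i → trans (keep₂ (ι i)) (keep₁ i))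
                        (trans (reflexive (eval-instruction o (ι′ x) y env₂))
                               (apply-cong o (trans (keep₂ x) x≈) y≈))))
        where
        reorder : ⟨ s ⟩ ℕ.+ (⟨ t ⟩ ℕ.+ suc b) ≡ 1 ℕ.+ (⟨ s ⟩ ℕ.+ ⟨ t ⟩) ℕ.+ b
        reorder = solve 3 (λ s t b → s :+ (t :+ (con 1 :+ b)) := con 1 :+ (s :+ t) :+ b) ≡.refl ⟨ s ⟩ ⟨ t ⟩ b
          where open +-*-Solver

      storeVector-correct : ∀ {V s} N (es : Fin N → Expr V s) σ {k} (ρ : V → Fin k) env →
        (∀ v → env (ρ v) ≈ σ v) → ∀ {κ : ∀ {l} → (Fin k → Fin l) → (Fin N → Fin l) → Tree r l} {b} →
        (∀ {l} (ι : Fin k → Fin l) ys env′ → (∀ i → env′ (ι i) ≈ env i) →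
          (∀ j → env′ (ys j) ≈ ⟦ es j ⟧ σ) → Sat (κ ι ys) env′ b) →
        Sat (storeVector N es ρ κ) env (N ℕ.* ⟨ s ⟩ ℕ.+ b)
      storeVector-correct zero    es σ ρ env ρ≈σ k = k id [] env (λ _ → refl) λ ()
      storeVector-correct {s = s} (suc N) es σ ρ env ρ≈σ {b = b} k =
        Sat-weaken (ℕ.≤-reflexive (≡.sym (ℕ.+-assoc ⟨ s ⟩ (N ℕ.* ⟨ s ⟩) b)))
        (compile-correct (es zero) σ ρ env ρ≈σ λ ι x env₁ keep₁ x≈ →
         storeVector-correct N (es ∘ suc) σ (ι ∘ ρ) env₁ (λ v → trans (keep₁ (ρ v)) (ρ≈σ v)) λ ι′ ys env₂ keep₂ ys≈ →
         k (ι′ ∘ ι) (ι′ x ∷ ys) env₂ (λ i → trans (keep₂ (ι i)) (keep₁ i))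
           λ { zero → trans (keep₂ x) x≈ ; (suc j) → ys≈ j })

      compareVectors-correct : ∀ {V s t} N (es : Fin N → Expr V s) (fs : Fin N → Expr V t) σ {k} (ρ : V → Fin k) env →
        (∀ v → env (ρ v) ≈ σ v) → ∀ {κ : ∀ {l} → (Fin k → Fin l) → (Fin N → Bool) → Tree r l} {b} →
        (∀ {l} (ι : Fin k → Fin l) bs env′ → (∀ i → env′ (ι i) ≈ env i) →
          (∀ j → Reflects (⟦ es j ⟧ σ ≈ ⟦ fs j ⟧ σ) (bs j)) → Sat (κ ι bs) env′ b) →
        Sat (compareVectors N es fs ρ κ) env (N ℕ.* (1 ℕ.+ (⟨ s ⟩ ℕ.+ ⟨ t ⟩)) ℕ.+ b)
      compareVectors-correct zero    es fs σ ρ env ρ≈σ k = k id [] env (λ _ → refl) λ ()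
      compareVectors-correct {s = s} {t} (suc N) es fs σ ρ env ρ≈σ {b = b} k =
        Sat-weaken (ℕ.≤-reflexive reorder)
        (compile-correct (es zero) σ ρ env ρ≈σ λ ι x env₁ keep₁ x≈ →
         compile-correct (fs zero) σ (ι ∘ ρ) env₁ (λ v → trans (keep₁ (ρ v)) (ρ≈σ v)) λ ι′ y env₂ keep₂ y≈ →
         let keep = λ i → trans (keep₂ (ι i)) (keep₁ i)
             x≈′ = trans (keep₂ x) x≈
             continue = λ {b} (reflects : Reflects (⟦ es zero ⟧ σ ≈ ⟦ fs zero ⟧ σ) b) →
               compareVectors-correct N (es ∘ suc) (fs ∘ suc) σ (ι′ ∘ ι ∘ ρ) env₂ (λ v → trans (keep (ρ v)) (ρ≈σ v))
                 λ ι″ bs env₃ keep₃ bs≈ → k (ι″ ∘ ι′ ∘ ι) (b ∷ bs) env₃ (λ i → trans (keep₃ (ι′ (ι i))) (keep i))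
                   λ { zero → reflects ; (suc j) → bs≈ j }
         in Sat-ifEqual (λ eq  → continue (ofʸ (trans (sym x≈′) (trans eq y≈))))
                        (λ neq → continue (ofⁿ λ eq → neq (trans x≈′ (trans eq (sym y≈))))))
        where
        reorder : ⟨ s ⟩ ℕ.+ (⟨ t ⟩ ℕ.+ suc (N ℕ.* (1 ℕ.+ (⟨ s ⟩ ℕ.+ ⟨ t ⟩)) ℕ.+ b)) ≡
                  suc N ℕ.* (1 ℕ.+ (⟨ s ⟩ ℕ.+ ⟨ t ⟩)) ℕ.+ b
        reorder = solve 4 (λ s t N b → s :+ (t :+ (con 1 :+ (N :* (con 1 :+ (s :+ t)) :+ b)))
                                       := (con 1 :+ N) :* (con 1 :+ (s :+ t)) :+ b) ≡.refl ⟨ s ⟩ ⟨ t ⟩ N b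
          where open +-*-Solver

      store-meets : ∀ {V I s N} (fin : Fin N ↔ I) (es : I → Expr V s) (p : Prog (V ⊎ I)) {σ b} →
        Meets p [ σ , (λ i → ⟦ es i ⟧ σ) ] b → Meets (store fin es p) σ (N ℕ.* ⟨ s ⟩ ℕ.+ b)
      store-meets fin es p {σ} meets ρ env ρ≈σ =
        storeVector-correct _ (es ∘ Inverse.to fin) σ ρ env ρ≈σ λ ι ys env′ keep ys≈ →
        meets _ env′ λ
          { (inj₁ v) → trans (keep (ρ v)) (ρ≈σ v)
          ; (inj₂ i) → trans (ys≈ (Inverse.from fin i))
              (reflexive (≡.cong (λ j → ⟦ es j ⟧ σ) (Inverse.strictlyInverseˡ fin i))) }

      compare-meets : ∀ {V} {I : Set} {s t N} (fin : Fin N ↔ I) (es : I → Expr V s) (fs : I → Expr V t)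
        (p : (I → Bool) → Prog V) {σ b} →
        (∀ bs → (∀ i → Reflects (⟦ es i ⟧ σ ≈ ⟦ fs i ⟧ σ) (bs i)) → Meets (p bs) σ b) →
        Meets (compare fin es fs p) σ (N ℕ.* (1 ℕ.+ (⟨ s ⟩ ℕ.+ ⟨ t ⟩)) ℕ.+ b)
      compare-meets fin es fs p {σ} meets ρ env ρ≈σ =
        compareVectors-correct _ (es ∘ Inverse.to fin) (fs ∘ Inverse.to fin) σ ρ env ρ≈σ λ ι bs env′ keep bs≈ →
        meets (bs ∘ Inverse.from fin)
          (λ i → ≡.subst (λ j → Reflects (⟦ es j ⟧ σ ≈ ⟦ fs j ⟧ σ) (bs (Inverse.from fin i)))
                         (Inverse.strictlyInverseˡ fin i) (bs≈ (Inverse.from fin i)))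
          _ env′ λ v → trans (keep (ρ v)) (ρ≈σ v)

      return-meets : ∀ {V} (o : Fin r → V) {σ} → (∀ out → (∀ i → out i ≈ σ (o i)) → Q out) → Meets (return o) σ 0
      return-meets o post ρ env ρ≈σ = sat z≤n (post _ λ i → ρ≈σ (o i))

      relabel-meets : ∀ {V W} (f : W → V) (p : Prog W) {σ τ b} →
        (∀ w → σ (f w) ≈ τ w) → Meets p τ b → Meets (relabel f p) σ b
      relabel-meets f p σf≈τ meets ρ env ρ≈σ = meets (ρ ∘ f) env λ w → trans (ρ≈σ (f w)) (σf≈τ w)

      Meets-weaken : ∀ {V} (p : Prog V) {σ b b′} → b ℕ.≤ b′ → Meets p σ b → Meets p σ b′
      Meets-weaken p b≤b′ meets ρ env ρ≈σ = Sat-weaken b≤b′ (meets ρ env ρ≈σ)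

-- The algorithm and its operation count.

open import Data.Nat using (_*_; _≤_)

reflects-false : ∀ {a} {A : Set a} {b} → Reflects A b → b ≡ false → ¬ A
reflects-false (ofⁿ ¬a) ≡.refl = ¬a

reflects-≢false : ∀ {a} {A : Set a} {b} → Reflects A b → b ≢ false → A
reflects-≢false (ofʸ a) _  = a
reflects-≢false (ofⁿ _) ≢f = contradiction ≡.refl ≢f

-- Inner entries of nested products are not stored but recomputed at each use. The nesting depth is
-- fixed, so the sizes remain polynomial.
applySize : Polynomial₂ → Polynomial₂ → Polynomial₂
applySize a x = con 1 ⊕ (X ⊗ (con 1 ⊕ (con 1 ⊕ (x ⊕ a))))

entrySize productSize updateSize rowSize sourceSize sinkSize edgeSize testsSize roundSize totalSize : Polynomial₂
entrySize   = con 1 ⊕ (con 0 ⊕ (con 1 ⊕ (Y ⊗ (con 1 ⊕ (con 1 ⊕ (con 1 ⊕ con 0))))))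
productSize = applySize entrySize (applySize (con 0) entrySize)
updateSize  = con 1 ⊕ (con 0 ⊕ (con 1 ⊕
  ((con 1 ⊕ ((con 1 ⊕ (con 1 ⊕ applySize (con 0) entrySize)) ⊕ (con 1 ⊕ (entrySize ⊕ productSize))))
  ⊕ (con 1 ⊕ (con 1 ⊕ applySize entrySize (con 0))))))
rowSize     = (X ⊗ (con 1 ⊕ (entrySize ⊕ productSize))) ⊕ ((X ⊗ X) ⊗ updateSize)
sourceSize  = (Y ⊗ (X ⊗ X)) ⊗ (con 1 ⊕ (applySize (con 0) (applySize (con 0) entrySize) ⊕ con 0))
sinkSize    = (Y ⊗ (X ⊗ X)) ⊗ (con 1 ⊕ (applySize entrySize (applySize (con 0) (con 0)) ⊕ con 0))
edgeSize    = (Y ⊗ (Y ⊗ (X ⊗ X))) ⊗ (con 1 ⊕ (applySize (con 0) (applySize (con 0) (con 0)) ⊕ con 1))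
testsSize   = sourceSize ⊕ (sinkSize ⊕ edgeSize)
roundSize   = ((X ⊗ X) ⊗ con 1) ⊕ ((X ⊗ rowSize) ⊕ testsSize)
totalSize   = ((con 1 ⊕ X) ⊗ roundSize) ⊕ ((Y ⊗ con 1) ⊕ con 0)

-- The bits α, the outcomes of the comparisons and the path search live outside the tree: values
-- are computed only for the entries of the inputs, of G and of matrix products.
module Algorithm (m n : ℕ) where
  open Programs m n

  Input Registers : Set
  Input     = Fin (suc n) × (Fin m × Fin m)
  Registers = Input ⊎ (Fin m × Fin m)

  square : Fin (m * m) ↔ (Fin m × Fin m)
  square = *↔×

  _×-fin_ : ∀ {I : Set} {N} k → Fin N ↔ I → Fin (k * N) ↔ (Fin k × I)
  k ×-fin fin = (↔-id (Fin k) ×-↔ fin) ↔-∘ *↔×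

  matrixEntry : (Fin n → Bool) → Fin m → Fin m → Expr Registers entrySize
  matrixEntry α i j =
    op plus (var (inj₁ (zero , i , j))) (∑ Y λ k → op times (bit (α k)) (var (inj₁ (suc k , i , j))))

  inputEntry : Fin n → Fin m → Fin m → Expr Registers (con 0)
  inputEntry k i j = var (inj₁ (suc k , i , j))

  inverseEntry : Fin m → Fin m → Expr Registers (con 0)
  inverseEntry i j = var (inj₂ (i , j))

  infixr 7 _∙_
  _∙_ : ∀ {V a x} → (Fin m → Fin m → Expr V a) → (Fin m → Expr V x) → Fin m → Expr V (applySize a x)
  (M ∙ x) i = ∑ X λ j → op times (x j) (M i j)

  productEntry : (Fin n → Bool) → Fin m → Fin m → Expr Registers productSize
  productEntry α i j = (matrixEntry α ∙ inverseEntry ∙ transpose (matrixEntry α) j) i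

  update : (Fin n → Bool) → Fin m → Fin m → Fin m × Fin m → Expr Registers updateSize
  update α p q (i , j) = op plus (inverseEntry i j) (op times
    (op over (op minus (bit (does (q Fin.≟ i))) ((inverseEntry ∙ transpose (matrixEntry α) q) i))
             (op minus (matrixEntry α p q) (productEntry α p q)))
    (op minus (bit (does (p Fin.≟ j))) ((matrixEntry α ∙ transpose inverseEntry j) p)))

  -- All new entries of G are computed from the old ones before the names are switched to them.
  overwrite : Registers → Registers ⊎ (Fin m × Fin m)
  overwrite (inj₁ v)  = inj₁ (inj₁ v)
  overwrite (inj₂ ij) = inj₂ ij

  pivotStep : ∀ {bs : Fin m → Bool} → (Fin n → Bool) → Fin m → Dec (∃ λ q → bs q ≡ false) →
              Prog {n} Registers → Prog {n} Registers
  pivotStep α p (yes (q , _)) κ = store square (update α p q) (relabel overwrite κ)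
  pivotStep α p (no _)        κ = κ

  eliminateRow : (Fin n → Bool) → Fin m → Prog {n} Registers → Prog {n} Registers
  eliminateRow α p κ = compare (↔-id (Fin m)) (matrixEntry α p) (productEntry α p) λ bs →
    pivotStep α p (any? λ q → bs q Bool.≟ false) κ

  eliminate : (Fin n → Bool) → ∀ l → (Fin l → Fin m) → Prog {n} Registers → Prog {n} Registers
  eliminate α zero    rows κ = κ
  eliminate α (suc l) rows κ = eliminateRow α (rows zero) (eliminate α l (rows ∘ suc) κ)

  HasFalse : (Fin m × Fin m → Bool) → Set
  HasFalse bs = ∃₂ λ i j → bs (i , j) ≡ false

  hasFalse? : ∀ bs → Dec (HasFalse bs)
  hasFalse? bs = any? λ i → any? λ j → bs (i , j) Bool.≟ false

  inputAt : Fin n × (Fin m × Fin m) → Expr Registers (con 0)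
  inputAt (k , i , j) = inputEntry k i j

  sourceProduct : (Fin n → Bool) → Fin n × (Fin m × Fin m) →
                  Expr Registers (applySize (con 0) (applySize (con 0) entrySize))
  sourceProduct α (k , i , j) = (inputEntry k ∙ inverseEntry ∙ transpose (matrixEntry α) j) i

  sinkProduct : (Fin n → Bool) → Fin n × (Fin m × Fin m) →
                Expr Registers (applySize entrySize (applySize (con 0) (con 0)))
  sinkProduct α (k , i , j) = (matrixEntry α ∙ inverseEntry ∙ transpose (inputEntry k) j) i

  edgeProduct : Fin n × (Fin n × (Fin m × Fin m)) → Expr Registers (applySize (con 0) (applySize (con 0) (con 0)))
  edgeProduct (k , l , i , j) = (inputEntry l ∙ inverseEntry ∙ transpose (inputEntry k) j) i

  module Graph (sources sinks : Fin n × (Fin m × Fin m) → Bool) (edges : Fin n × (Fin n × (Fin m × Fin m)) → Bool) =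
    ShortestPath {n} (λ k → HasFalse λ ij → sources (k , ij)) (λ k → HasFalse λ ij → sinks (k , ij))
      (λ k l → HasFalse λ ij → edges (k , l , ij))
      (λ k → hasFalse? λ ij → sources (k , ij)) (λ k → hasFalse? λ ij → sinks (k , ij))
      (λ k l → hasFalse? λ ij → edges (k , l , ij))

  toggle : ∀ {P : Fin n → Set} → (∀ k → Dec (P k)) → (Fin n → Bool) → Fin n → Bool
  toggle P? α k = if does (P? k) then not (α k) else α k

  outputBits : (Fin n → Bool) → Prog {n} Input
  outputBits α = store (↔-id (Fin n)) (bit ∘ α) (return inj₂)

  mutual
    rounds : ℕ → (Fin n → Bool) → Prog {n} Input
    -- A default, never reached from `suc m` rounds.
    rounds zero    α = outputBits α
    rounds (suc f) α = store square (λ _ → bit false) (eliminate α m id (findSources f α))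

    findSources : ℕ → (Fin n → Bool) → Prog {n} Registers
    findSources f α = compare (n ×-fin square) (sourceProduct α) inputAt (findSinks f α)

    findSinks : ℕ → (Fin n → Bool) → (Fin n × (Fin m × Fin m) → Bool) → Prog {n} Registers
    findSinks f α sources = compare (n ×-fin square) (sinkProduct α) inputAt (findEdges f α sources)

    findEdges : ℕ → (Fin n → Bool) → (sources sinks : Fin n × (Fin m × Fin m) → Bool) → Prog {n} Registers
    findEdges f α sources sinks = compare (n ×-fin (n ×-fin square)) edgeProduct (λ _ → bit false) λ edges →
      -- G belongs to the current bits, so its registers are dropped and the next round builds its
      -- own.
      relabel inj₁ (nextRound f α sources sinks edges (Graph.search sources sinks edges))

    nextRound : ℕ → (Fin n → Bool) → ∀ sources sinks edges →
      let open Graph sources sinks edges in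
      (∃ λ t → ∃ λ k → (HasFalse λ ij → sources (k , ij)) × Path t k) ⊎ Closed → Prog {n} Input
    nextRound f α sources sinks edges (inj₁ (_ , _ , _ , p)) =
      rounds f (toggle (λ k → Graph._∈?_ sources sinks edges k p) α)
    nextRound f α sources sinks edges (inj₂ _)               = outputBits α

  algorithm : Tree n (suc n * (m * m))
  -- At most m flips, and one more round to discover that no path is left.
  algorithm = rounds (suc m) (λ _ → false) λ (k , i , j) → combine k (combine i j)

  -- Correctness of the algorithm over an arbitrary field.

  module Correctness {c ℓ} (F : Field c ℓ) where
    open Field F hiding (zero; _*_)
    open LinearAlgebra F
    open VectorSpaces F renaming (bit to bitValue)
    open Matrices F
    open Augmentation F
    open Semantics F
    open SetoidReasoning setoid

    -- This lets finitely many entry tests, on the columns of `K`, decide an identity that is used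
    -- for all vectors.
    columnwise : (M N K : Matrix m m) → ∀ x → M · N · K · x ≋ lincomb x λ j → M · N · transpose K j
    columnwise M N K x i = trans (·-congˡ M (·-lincomb N x (transpose K)) i) (·-lincomb M x (λ j → N · transpose K j) i)

    module _ (M N K L : Matrix m m) (bs : Fin m × Fin m → Bool)
      (reflects : ∀ i j → Reflects ((M · N · transpose K j) i ≈ L i j) (bs (i , j))) where

      columns-differ : HasFalse bs → ∃₂ λ x i → ¬ (M · N · K · x) i ≈ (L · x) i
      columns-differ (i , j , eq) = unit j , i , λ agree → reflects-false (reflects i j) eq (begin
        (M · N · transpose K j) i                               ≈⟨ lincomb-unit j (λ j → M · N · transpose K j) i ⟨
        lincomb (unit j) (λ j → M · N · transpose K j) i        ≈⟨ columnwise M N K (unit j) i ⟨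
        (M · N · K · unit j) i                                  ≈⟨ agree ⟩
        (L · unit j) i                                          ≈⟨ lincomb-unit j (transpose L) i ⟩
        L i j                                                   ∎)

      columns-agree : ¬ HasFalse bs → ∀ x → M · N · K · x ≋ L · x
      columns-agree none x i = trans (columnwise M N K x i)
        (lincomb-congʳ x (λ j i → reflects-≢false (reflects i j) λ eq → none (i , j , eq)) i)

    flip-nonzero : ∀ b → ¬ bitValue (not b) - bitValue b ≈ 0#
    flip-nonzero true  eq = 1≉0 (sym (x∙y⁻¹≈ε⇒x≈y _ _ eq))
    flip-nonzero false eq = 1≉0 (x∙y⁻¹≈ε⇒x≈y _ _ eq)

    module _ {P : Fin n → Set} (P? : ∀ k → Dec (P k)) (α : Fin n → Bool) where

      toggle-on : ∀ k → P k → ¬ bitValue (toggle P? α k) - bitValue (α k) ≈ 0#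
      toggle-on k Pk with P? k
      ... | yes _  = flip-nonzero (α k)
      ... | no ¬Pk = contradiction Pk ¬Pk

      toggle-off : ∀ k → ¬ P k → bitValue (toggle P? α k) - bitValue (α k) ≈ 0#
      toggle-off k ¬Pk with P? k
      ... | yes Pk = contradiction Pk ¬Pk
      ... | no _   = -‿inverseʳ _

    module _ (B₀ : Matrix m m) (B : Vector (Matrix m m) n) (B-rank : ∀ k → HasRank (B k) 1) where

      open Hoare (IsMaxRankCompletion B₀ B)

      matrix : (Fin n → Bool) → Matrix m m
      matrix α = completion B₀ B (bitValue ∘ α)

      input : Input → Carrier
      input (k , i , j) = (B₀ ∷ B) k i j

      registers : Matrix m m → Registers → Carrier
      registers G = [ input , (λ (i , j) → G i j) ]

      -- The continuation is asked to work for every `G′` that keeps finished rows and finishes row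
      -- `p`; in this form the steps for successive rows compose.
      eliminateRow-meets : ∀ α p (κ : Prog Registers) G b →
        (∀ G′ → (∀ i → RowDone (matrix α) G i → RowDone (matrix α) G′ i) → RowDone (matrix α) G′ p →
          Meets κ (registers G′) b) →
        Meets (eliminateRow α p κ) (registers G) (⟨ rowSize ⟩ ℕ.+ b)
      eliminateRow-meets α p κ G b κ-meets =
        Meets-weaken (eliminateRow α p κ) (ℕ.≤-reflexive (≡.sym (ℕ.+-assoc (m * _) (m * m * ⟨ updateSize ⟩) b)))
          (compare-meets (↔-id (Fin m)) (matrixEntry α p) (productEntry α p) _ λ bs reflects →
            step bs reflects (any? λ q → bs q Bool.≟ false))
        where
        A = matrix α

        step : ∀ bs → (∀ q → Reflects (A p q ≈ (A · G · transpose A q) p) (bs q)) →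
               (found : Dec (∃ λ q → bs q ≡ false)) →
               Meets (pivotStep {bs} α p found κ) (registers G) (m * m * ⟨ updateSize ⟩ ℕ.+ b)
        step bs reflects (no none) = Meets-weaken κ (ℕ.m≤n+m b _) (κ-meets G (λ _ done → done) done)
          where
          done : RowDone A G p
          done q = reflects-≢false (reflects q) λ eq → none (q , eq)
        step bs reflects (yes (q , eq)) =
          store-meets square (update α p q) (relabel overwrite κ)
            (relabel-meets overwrite κ {τ = registers G′} (λ { (inj₁ _) → refl ; (inj₂ _) → refl })
              (κ-meets G′ (keeps-rows pivot≉0) (new-row pivot≉0)))
          where
          open Pivot A G p q
          pivot≉0 : ¬ pivot ≈ 0#
          pivot≉0 pivot≈0 = reflects-false (reflects q) eq (x∙y⁻¹≈ε⇒x≈y _ _ pivot≈0)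

      eliminate-meets : ∀ α l (rows : Fin l → Fin m) (κ : Prog Registers) G b →
        (∀ G′ → (∀ i → RowDone (matrix α) G i → RowDone (matrix α) G′ i) →
          (∀ s → RowDone (matrix α) G′ (rows s)) → Meets κ (registers G′) b) →
        Meets (eliminate α l rows κ) (registers G) (l * ⟨ rowSize ⟩ ℕ.+ b)
      eliminate-meets α zero    rows κ G b κ-meets = κ-meets G (λ _ done → done) λ ()
      eliminate-meets α (suc l) rows κ G b κ-meets =
        Meets-weaken (eliminate α (suc l) rows κ) (ℕ.≤-reflexive (≡.sym (ℕ.+-assoc ⟨ rowSize ⟩ (l * ⟨ rowSize ⟩) b)))
          (eliminateRow-meets α (rows zero) _ G _ λ G₁ keep₁ done₁ →
           eliminate-meets α l (rows ∘ suc) κ G₁ b λ G₂ keep₂ done₂ →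
           κ-meets G₂ (λ i → keep₂ i ∘ keep₁ i) λ { zero → keep₂ _ done₁ ; (suc s) → done₂ s })

      outputBits-meets : ∀ α → (∀ out → out ≋ bitValue ∘ α → IsMaxRankCompletion B₀ B out) →
        Meets (outputBits α) input ⟨ (Y ⊗ con 1) ⊕ con 0 ⟩
      outputBits-meets α post = store-meets (↔-id (Fin n)) (bit ∘ α) (return inj₂) (return-meets inj₂ post)

      module Round (α : Fin n → Bool) (G : Matrix m m) (done : ∀ i → RowDone (matrix α) G i)
        {sources sinks : Fin n × (Fin m × Fin m) → Bool} {edges : Fin n × (Fin n × (Fin m × Fin m)) → Bool}
        (sources≈ : ∀ k i j → Reflects ((B k · G · transpose (matrix α) j) i ≈ B k i j) (sources (k , i , j)))
        (sinks≈ : ∀ k i j → Reflects ((matrix α · G · transpose (B k) j) i ≈ B k i j) (sinks (k , i , j)))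
        (edges≈ : ∀ k l i j → Reflects ((B l · G · transpose (B k) j) i ≈ 0#) (edges (k , l , i , j)))
        where
        open Graph sources sinks edges

        A = matrix α

        O : Matrix m m
        O _ _ = 0#

        O·≈0 : ∀ x i → (O · x) i ≈ 0#
        O·≈0 x = lincomb-zero x λ _ _ → refl

        AGA : ∀ x → A · G · A · x ≋ A · x
        AGA x i = trans (columnwise A G A x i) (lincomb-congʳ x (λ j i → sym (done i j)) i)

        edge⁻ : ∀ k l → ¬ (HasFalse λ ij → edges (k , l , ij)) → ∀ x i → (B l · G · B k · x) i ≈ 0#
        edge⁻ k l none x i = trans (columns-agree (B l) G (B k) O _ (edges≈ k l) none x i) (O·≈0 x i)

        edge⁺ : ∀ k l → (HasFalse λ ij → edges (k , l , ij)) → ∃₂ λ x i → ¬ (B l · G · B k · x) i ≈ 0#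
        edge⁺ k l some with columns-differ (B l) G (B k) O _ (edges≈ k l) some
        ... | x , i , differ = x , i , λ eq → differ (trans eq (sym (O·≈0 x i)))

        optimal : Closed → ∀ out → out ≋ bitValue ∘ α → IsMaxRankCompletion B₀ B out
        optimal closed out out≋α with basis (transpose (completion B₀ B out))
        ... | r , rank = r , rank , λ β s rank′ →
          rank-bound C (completion B₀ B β) G B (λ k → β k - out k) S S?
            (completion-shift B₀ B out β)
            (λ k k∈S x i → trans (C·≋A· (G · B k · x) i)
              (columns-agree A G (B k) (B k) _ (sinks≈ k) (sink⇒ k k∈S) x i))
            (λ k k∉S x i → trans (·-congˡ (B k) (·-congˡ G (C·≋A· x)) i)
              (columns-agree (B k) G A (B k) _ (sources≈ k) (k∉S ∘ source⇒ k) x i))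
            (λ k l k∈S l∉S → edge⁻ k l (l∉S ∘ edge⇒ k l k∈S))
            rank rank′
          where
          open Closed closed
          -- The output equals the bits only up to `_≈_`, so its completion is tied to `A` through
          -- the action on vectors.
          C = completion B₀ B out
          C·≋A· : ∀ x → C · x ≋ A · x
          C·≋A· = ·-congʳ (completion-cong B₀ B out≋α)

        module Augmented {t k} (source : HasFalse λ ij → sources (k , ij)) (p : Path t k) where

          α′ : Fin n → Bool
          α′ = toggle (_∈? p) α

          open Kernel A (matrix α′) G B (λ l → bitValue (α′ l) - bitValue (α l)) B-rank
            (completion-shift B₀ B (bitValue ∘ α) (bitValue ∘ α′)) AGA
            {source? = λ k → hasFalse? λ ij → sources (k , ij)} {sink? = λ k → hasFalse? λ ij → sinks (k , ij)}
            {edge? = λ k l → hasFalse? λ ij → edges (k , l , ij)}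
            (λ k → columns-differ (B k) G A (B k) _ (sources≈ k)) (λ k → columns-agree (B k) G A (B k) _ (sources≈ k))
            (λ k → columns-differ A G (B k) (B k) _ (sinks≈ k)) (λ k → columns-agree A G (B k) (B k) _ (sinks≈ k))
            edge⁺ edge⁻

          extend : ∀ {t} (ws : Vector (Vector Carrier m) t) → LinearlyIndependent (λ j → A · ws j) →
                   ∃ λ w → LinearlyIndependent λ j → matrix α′ · (w ∷ ws) j
          extend ws li with kernel-witness source p (toggle-off (_∈? p) α) (toggle-on (_∈? p) α)
          ... | w , Aw≈0 , A′w≉0 = w , independent-extend A (matrix α′) ws w li
                  (kernel-shrinks source p (toggle-off (_∈? p) α) (toggle-on (_∈? p) α)) Aw≈0 A′w≉0

      roundsSize : ℕ → ℕ
      roundsSize f = f * ⟨ roundSize ⟩ ℕ.+ ⟨ (Y ⊗ con 1) ⊕ con 0 ⟩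

      mutual
        -- The family `ws` exists only in the proof. Each flip trades one remaining round for one
        -- more vector, so running out of rounds would leave m + 1 independent vectors of length m.
        rounds-meets : ∀ f α {t} (ws : Vector (Vector Carrier m) t) → LinearlyIndependent (λ j → matrix α · ws j) →
          t ℕ.+ f ≡ suc m → Meets (rounds f α) input (roundsSize f)
        rounds-meets zero α {t} ws li t+0≡1+m =
          contradiction (independent⇒≤ _ li) (ℕ.<⇒≱ (ℕ.≤-reflexive (≡.trans (≡.sym t+0≡1+m) (ℕ.+-identityʳ t))))
        rounds-meets (suc f) α ws li t+1+f≡1+m =
          Meets-weaken (rounds (suc f) α) (ℕ.≤-reflexive reorder)
            (store-meets square (λ _ → bit false) _
              (eliminate-meets α m id _ (λ _ _ → 0#) _ λ G _ done →
                findSources-meets f α G done ws li t+1+f≡1+m))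
          where
          reorder : m * m * 1 ℕ.+ (m * ⟨ rowSize ⟩ ℕ.+ (⟨ testsSize ⟩ ℕ.+ roundsSize f)) ≡ roundsSize (suc f)
          reorder = solve 5 (λ s e t f o → s :+ (e :+ (t :+ (f :* (s :+ (e :+ t)) :+ o)))
                                           := (con 1 :+ f) :* (s :+ (e :+ t)) :+ o) ≡.refl
                          (m * m * 1) (m * ⟨ rowSize ⟩) ⟨ testsSize ⟩ f ⟨ (Y ⊗ con 1) ⊕ con 0 ⟩
            where open +-*-Solver

        findSources-meets : ∀ f α G → (∀ i → RowDone (matrix α) G i) →
          ∀ {t} (ws : Vector (Vector Carrier m) t) → LinearlyIndependent (λ j → matrix α · ws j) →
          t ℕ.+ suc f ≡ suc m → Meets (findSources f α) (registers G) (⟨ testsSize ⟩ ℕ.+ roundsSize f)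
        findSources-meets f α G done {t} ws li t+1+f≡1+m =
          Meets-weaken (findSources f α) (ℕ.≤-reflexive reassociate)
            (compare-meets (n ×-fin square) (sourceProduct α) inputAt (findSinks f α) λ sources sources≈ →
             compare-meets (n ×-fin square) (sinkProduct α) inputAt (findEdges f α sources) λ sinks sinks≈ →
             compare-meets (n ×-fin (n ×-fin square)) edgeProduct (λ _ → bit false)
               (λ edges → relabel inj₁ (nextRound f α sources sinks edges (Graph.search sources sinks edges)))
               λ edges edges≈ →
             relabel-meets inj₁ (nextRound f α sources sinks edges (Graph.search sources sinks edges)) {τ = input}
               (λ _ → refl)
               (next sources sinks edges (λ k i j → sources≈ (k , i , j)) (λ k i j → sinks≈ (k , i , j))
                 (λ k l i j → edges≈ (k , l , i , j)) (Graph.search sources sinks edges)))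
          where
          reassociate : ⟨ sourceSize ⟩ ℕ.+ (⟨ sinkSize ⟩ ℕ.+ (⟨ edgeSize ⟩ ℕ.+ roundsSize f)) ≡
                        ⟨ testsSize ⟩ ℕ.+ roundsSize f
          reassociate = solve 4 (λ s t e r → s :+ (t :+ (e :+ r)) := (s :+ (t :+ e)) :+ r) ≡.refl
                              ⟨ sourceSize ⟩ ⟨ sinkSize ⟩ ⟨ edgeSize ⟩ (roundsSize f)
            where open +-*-Solver

          next : ∀ sources sinks edges
            (sources≈ : ∀ k i j → Reflects ((B k · G · transpose (matrix α) j) i ≈ B k i j) (sources (k , i , j)))
            (sinks≈ : ∀ k i j → Reflects ((matrix α · G · transpose (B k) j) i ≈ B k i j) (sinks (k , i , j)))
            (edges≈ : ∀ k l i j → Reflects ((B l · G · transpose (B k) j) i ≈ 0#) (edges (k , l , i , j))) →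
            ∀ result → Meets (nextRound f α sources sinks edges result) input (roundsSize f)
          next sources sinks edges sources≈ sinks≈ edges≈ (inj₁ (_ , _ , source , p)) =
            let module R = Round α G done sources≈ sinks≈ edges≈
                module Next = R.Augmented source p
            in rounds-meets f Next.α′ (proj₁ (Next.extend ws li) ∷ ws) (proj₂ (Next.extend ws li))
                 (≡.trans (≡.sym (ℕ.+-suc t f)) t+1+f≡1+m)
          next sources sinks edges sources≈ sinks≈ edges≈ (inj₂ closed) =
            Meets-weaken (outputBits α) (ℕ.m≤n+m _ (f * ⟨ roundSize ⟩))
              (outputBits-meets α (Round.optimal α G done sources≈ sinks≈ edges≈ closed))

      concat-combine : ∀ {a} {A : Set a} {k l} (xss : Vector (Vector A l) k) i j → concat xss (combine i j) ≡ xss i j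
      concat-combine xss i j = ≡.cong (uncurry xss) (remQuot-combine i j)

      open Execution F using (cost; run; encode)

      algorithm-correct : cost algorithm (encode B₀ B) ℕ.≤ ⟨ totalSize ⟩ ×
                          IsMaxRankCompletion B₀ B (run algorithm (encode B₀ B))
      algorithm-correct = Sat.cost≤ result , Sat.post result
        where
        result : Sat algorithm (encode B₀ B) ⟨ totalSize ⟩
        result = rounds-meets (suc m) (λ _ → false) [] (λ _ _ ()) ≡.refl _ (encode B₀ B) λ (k , i , j) →
          reflexive (≡.trans (concat-combine (map concat (B₀ ∷ B)) k (combine i j)) (concat-combine ((B₀ ∷ B) k) i j))

theorem1p1 : (c ℓ : Level) →
  Σ[ alg ∈ ((m n : ℕ) → Tree n (suc n * (m * m))) ]
  Σ[ p ∈ Polynomial₂ ]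
  ((F : Field c ℓ) →
   let open LinearAlgebra F
       open Execution F
   in (m n : ℕ) (B₀ : Matrix m m) (B : Vector (Matrix m m) n) →
      (∀ i → HasRank (B i) 1) →
      cost (alg m n) (encode B₀ B) ≤ evalPoly p m n ×
      IsMaxRankCompletion B₀ B (run (alg m n) (encode B₀ B)))
theorem1p1 c ℓ = Algorithm.algorithm , totalSize , λ F m n → Algorithm.Correctness.algorithm-correct m n F
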